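{- For every prime $p > 2.67\times 10^{32}$, the least primitive root $g(p)$ modulo $p$ satisfies $g(p) < p^{0.6309}$.
   Context: For a prime $p$, $g(p)$ denotes the least positive integer that is a primitive root modulo $p$. -}

module Defs where

open import Data.Nat using (ℕ; suc; _∸_; _^_; _<_; _≤_; _%_; NonZero)
open import Data.Nat.Primality using (Prime)
open import Data.Product using (_×_)
open import Relation.Binary.PropositionalEquality using (_≡_; _≢_)

IsPrimitiveRoot : (p : ℕ) → .{{NonZero p}} → ℕ → Set
IsPrimitiveRoot p g =
  ((g ^ (p ∸ 1)) % p ≡ 1 % p) ×
  (∀ k → 1 ≤ k → k < p ∸ 1 → (g ^ k) % p ≢ 1 % p)

IsLeastPrimitiveRoot : (p : ℕ) → .{{NonZero p}} → ℕ → Set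
IsLeastPrimitiveRoot p g =
  (1 ≤ g) × IsPrimitiveRoot p g ×
  (∀ h → 1 ≤ h → h < g → IsPrimitiveRoot p h → Data.Empty.⊥)
  where import Data.Empty

{-# OPTIONS --safe #-}
module Submission where

-- Characters and Gauss sums are replaced by a second moment.  Let p = M + 1, let H be a subgroup of the units modulo
-- p, of order h, and put F = M·1_H − h·1_{units}, so that F sums to 0.  As x ↦ cx + b ranges over the affine maps, c
-- = 0 included, 2-transitivity gives ∑_{b,c} (∑_{v<N} F(b + cv))² = N p ∑F² exactly.  As F is H-invariant, the h
-- choices c ∈ H contribute equally, and Cauchy–Schwarz over an interval of b gives |M·#{u, v < N : 1 + u + v ∈ H} − h
-- N²| ≤ N √p M, as strong as the Pólya–Vinogradov bound.  Apply this to the subgroups H_D = {x : x^(M/D) = 1} of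
-- index D.  An x outside every H_q, q a prime divisor of M, is a primitive root; those x are counted by
-- inclusion–exclusion over the small q (the core) and a union bound over the remaining q (the rest).  Everything is
-- positive once N/√p exceeds 2^m (s + 1)/(θδ), where m and s are the sizes of core and rest, θ = ∏_{core} (1 − 1/q)
-- and δ = 1 − ∑_{rest} 1/q.  The resulting root is below 2N ≤ p^(5/8), and 5/8 < 0.6309.

-- The exponent 5/8 is a budget. The root is below 2(C + 1)P, with P close to √p and C an integer
-- bound for 2^m (s + 1)/(θδ); so it suffices that (2(C + 1))^8 is at most p, up to a factor
-- (17/16)^4 lost in rounding √p up. The obstacle is that C grows with the number of prime divisors
-- of M, so p must be bounded below in terms of that number. With the core below 11 and s ≤ 25 the
-- inequality asks for p ≥ 2.47·10^32, approximately, and rests on the hypothesis alone; s = 26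
-- would ask for 4.1·10^32. From 26 on, the product of the primes dividing M bounds p from below:
-- numerically up to s = 89, and beyond that uniformly, with a core that grows with the number ω of
-- prime divisors. Everything is arithmetic in ℕ and ℤ: θ, δ and the reciprocals 1/q are pairs of
-- numbers with denominators cleared, and √p is replaced by some P with p ≤ P². The sizes of the H_D
-- come from counting roots of polynomials, so neither cyclicity of the unit group nor the existence
-- of a primitive root is presupposed.

open import Defs
open import Data.Nat.Base using (ℕ; suc; NonZero)
open import Data.Nat.Primality using (Prime)

-- Finite sums of integers.

module Sums where

  open import Data.Nat.Base as ℕ using (ℕ; zero; suc; z≤n; s≤s)
  import Data.Nat.Properties as ℕ
  open import Data.Integer.Base using (ℤ; +_; -[1+_]; 0ℤ; 1ℤ; _+_; _*_; _-_; -_; _≤_; _<_; +≤+)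
  open import Data.Integer.Properties
  open import Data.Integer.Tactic.RingSolver using (solve-∀)
  open import Data.Fin.Base using (toℕ)
  open import Data.Fin.Properties using (toℕ<n)
  import Algebra.Properties.Semiring.Sum +-*-semiring as S
  open import Data.Product.Base using (∃-syntax; _×_; _,_)
  open import Relation.Nullary using (contradiction; yes; no)
  open import Relation.Binary.PropositionalEquality

  opaque

    -- Opaque because `p` is `suc M`: a transparent `∑ p f` would unfold to its first term plus the
    -- remaining sum.
    ∑ : ℕ → (ℕ → ℤ) → ℤ
    ∑ n f = S.sum {n} (λ i → f (toℕ i))

    ∑≡sum : ∀ n f → ∑ n f ≡ S.sum {n} (λ i → f (toℕ i))
    ∑≡sum n f = refl

    ∑-zero : ∀ f → ∑ 0 f ≡ 0ℤ
    ∑-zero f = refl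

    ∑-suc : ∀ n f → ∑ (suc n) f ≡ f 0 + ∑ n (λ i → f (suc i))
    ∑-suc n f = refl

    ∑-cong : ∀ n {f g} → (∀ i → i ℕ.< n → f i ≡ g i) → ∑ n f ≡ ∑ n g
    ∑-cong n f≗g = S.sum-cong-≗ {n} (λ i → f≗g (toℕ i) (toℕ<n i))

    ∑-+ : ∀ n f g → ∑ n (λ i → f i + g i) ≡ ∑ n f + ∑ n g
    ∑-+ n f g = S.∑-distrib-+ {n} (λ i → f (toℕ i)) (λ i → g (toℕ i))

    ∑-* : ∀ n c f → ∑ n (λ i → c * f i) ≡ c * ∑ n f
    ∑-* n c f = sym (S.*-distribˡ-sum {n} c (λ i → f (toℕ i)))

    ∑-*ʳ : ∀ n c f → ∑ n (λ i → f i * c) ≡ ∑ n f * c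
    ∑-*ʳ n c f = sym (S.*-distribʳ-sum {n} c (λ i → f (toℕ i)))

    ∑-comm : ∀ m n (f : ℕ → ℕ → ℤ) → ∑ m (λ i → ∑ n (f i)) ≡ ∑ n (λ j → ∑ m (λ i → f i j))
    ∑-comm m n f = S.∑-comm {m} {n} (λ i j → f (toℕ i) (toℕ j))

  ∑-cong′ : ∀ n {f g} → (∀ i → f i ≡ g i) → ∑ n f ≡ ∑ n g
  ∑-cong′ n f≗g = ∑-cong n (λ i _ → f≗g i)

  ∑-minus : ∀ n f g → ∑ n (λ i → f i - g i) ≡ ∑ n f - ∑ n g
  ∑-minus n f g = begin
    ∑ n (λ i → f i - g i)               ≡⟨ ∑-cong′ n (λ i → cong (_+_ (f i)) (sym (-1*i≡-i (g i)))) ⟩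
    ∑ n (λ i → f i + -[1+ 0 ] * g i)    ≡⟨ ∑-+ n f (λ i → -[1+ 0 ] * g i) ⟩
    ∑ n f + ∑ n (λ i → -[1+ 0 ] * g i)  ≡⟨ cong (_+_ (∑ n f)) (trans (∑-* n -[1+ 0 ] g) (-1*i≡-i (∑ n g))) ⟩
    ∑ n f - ∑ n g                       ∎
    where open ≡-Reasoning

  ∑-const : ∀ n c → ∑ n (λ _ → c) ≡ + n * c
  ∑-const zero    c = trans (∑-zero _) (sym (*-zeroˡ c))
  ∑-const (suc n) c = trans (∑-suc n _) (trans (cong (_+_ c) (∑-const n c)) (lemma c (+ n)))
    where
    lemma : ∀ c n → c + n * c ≡ (1ℤ + n) * c
    lemma = solve-∀

  ∑-snoc : ∀ n f → ∑ (suc n) f ≡ ∑ n f + f n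
  ∑-snoc zero    f = begin
    ∑ 1 f                     ≡⟨ ∑-suc 0 f ⟩
    f 0 + ∑ 0 (λ i → f (suc i)) ≡⟨ cong (_+_ (f 0)) (∑-zero (λ i → f (suc i))) ⟩
    f 0 + 0ℤ                  ≡⟨ +-comm (f 0) 0ℤ ⟩
    0ℤ + f 0                  ≡⟨ cong (λ s → s + f 0) (sym (∑-zero f)) ⟩
    ∑ 0 f + f 0               ∎
    where open ≡-Reasoning
  ∑-snoc (suc n) f = begin
    ∑ (suc (suc n)) f                           ≡⟨ ∑-suc (suc n) f ⟩
    f 0 + ∑ (suc n) (λ i → f (suc i))           ≡⟨ cong (_+_ (f 0)) (∑-snoc n (λ i → f (suc i))) ⟩
    f 0 + (∑ n (λ i → f (suc i)) + f (suc n))   ≡⟨ sym (+-assoc (f 0) (∑ n (λ i → f (suc i))) (f (suc n))) ⟩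
    f 0 + ∑ n (λ i → f (suc i)) + f (suc n)     ≡⟨ cong (λ s → s + f (suc n)) (sym (∑-suc n f)) ⟩
    ∑ (suc n) f + f (suc n)                     ∎
    where open ≡-Reasoning

  ∑-mono : ∀ n {f g} → (∀ i → i ℕ.< n → f i ≤ g i) → ∑ n f ≤ ∑ n g
  ∑-mono zero    {f} {g} f≤g = ≤-reflexive (trans (∑-zero f) (sym (∑-zero g)))
  ∑-mono (suc n) {f} {g} f≤g = subst₂ _≤_ (sym (∑-suc n f)) (sym (∑-suc n g))
    (+-mono-≤ (f≤g 0 ℕ.z<s) (∑-mono n (λ i i<n → f≤g (suc i) (s≤s i<n))))

  ∑-nonNeg : ∀ n {f} → (∀ i → 0ℤ ≤ f i) → 0ℤ ≤ ∑ n f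
  ∑-nonNeg n {f} 0≤f = subst (_≤ ∑ n f) (trans (∑-const n 0ℤ) (*-zeroʳ (+ n))) (∑-mono n (λ i _ → 0≤f i))

  ∑-prefix : ∀ {m n f} → m ℕ.≤ n → (∀ i → 0ℤ ≤ f i) → ∑ m f ≤ ∑ n f
  ∑-prefix {n = n} {f} z≤n 0≤f = subst (_≤ ∑ n f) (sym (∑-zero f)) (∑-nonNeg n 0≤f)
  ∑-prefix {suc m} {suc n} {f} (s≤s m≤n) 0≤f = subst₂ _≤_ (sym (∑-suc m f)) (sym (∑-suc n f))
    (+-monoʳ-≤ (f 0) (∑-prefix m≤n (λ i → 0≤f (suc i))))

  ∑-single : ∀ n k {f} → k ℕ.< n → (∀ i → i ℕ.< n → i ≢ k → f i ≡ 0ℤ) → ∑ n f ≡ f k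
  ∑-single (suc n) zero {f} _ f≡0 = begin
    ∑ (suc n) f                 ≡⟨ ∑-suc n f ⟩
    f 0 + ∑ n (λ i → f (suc i)) ≡⟨ cong (_+_ (f 0)) (∑-cong n (λ i i<n → f≡0 (suc i) (s≤s i<n) λ ())) ⟩
    f 0 + ∑ n (λ _ → 0ℤ)        ≡⟨ cong (_+_ (f 0)) (trans (∑-const n 0ℤ) (*-zeroʳ (+ n))) ⟩
    f 0 + 0ℤ                    ≡⟨ +-identityʳ (f 0) ⟩
    f 0                         ∎
    where open ≡-Reasoning
  ∑-single (suc n) (suc k) {f} (s≤s k<n) f≡0 = begin
    ∑ (suc n) f                 ≡⟨ ∑-suc n f ⟩
    f 0 + ∑ n (λ i → f (suc i)) ≡⟨ cong₂ _+_ (f≡0 0 ℕ.z<s λ ()) (∑-single n k k<n (λ i i<n i≢k → f≡0 (suc i) (s≤s i<n) (λ eq → i≢k (ℕ.suc-injective eq)))) ⟩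
    0ℤ + f (suc k)              ≡⟨ +-identityˡ (f (suc k)) ⟩
    f (suc k)                   ∎
    where open ≡-Reasoning

  ∑-diagonal : ∀ n (T : ℕ → ℕ → ℤ) → (∀ i j → i ℕ.< n → j ℕ.< n → i ≢ j → T i j ≡ 0ℤ) →
               ∑ n (λ i → ∑ n (T i)) ≡ ∑ n (λ i → T i i)
  ∑-diagonal n T off = ∑-cong n λ i i<n → ∑-single n i i<n (λ j j<n j≢i → off i j i<n j<n (λ eq → j≢i (sym eq)))

  ∑-*-∑ : ∀ n f g → ∑ n f * ∑ n g ≡ ∑ n (λ i → ∑ n (λ j → f i * g j))
  ∑-*-∑ n f g = trans (sym (∑-*ʳ n (∑ n g) f)) (∑-cong′ n (λ i → sym (∑-* n (f i) g)))

  0≤i*i : ∀ i → 0ℤ ≤ i * i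
  0≤i*i (+ n)     = subst (0ℤ ≤_) (pos-* n n) (+≤+ z≤n)
  0≤i*i -[1+ n ]  = +≤+ z≤n

  -- Summing the squares of the deviations n f(i) - s over i gives n (n q - s²), which is
  -- nonnegative; the factor n is then cancelled, so no mean value has to be formed.
  cauchy : ∀ n f → ∑ n f * ∑ n f ≤ + n * ∑ n (λ i → f i * f i)
  cauchy zero        f = ≤-reflexive (trans (cong (_* ∑ 0 f) (∑-zero f)) (sym (*-zeroˡ (∑ 0 (λ i → f i * f i)))))
  cauchy n@(suc n-1) f = *-cancelˡ-≤-pos _ _ (+ n) (0≤i-j⇒j≤i (subst (0ℤ ≤_) expand
                           (∑-nonNeg n (λ i → 0≤i*i (+ n * f i - s)))))
    where
    s = ∑ n f
    q = ∑ n (λ i → f i * f i)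
    c = + 2 * + n * s
    open ≡-Reasoning
    square : ∀ n x s → (n * x - s) * (n * x - s) ≡ n * n * (x * x) - (+ 2 * n * s) * x + s * s
    square = solve-∀
    collect : ∀ n s q → n * n * q - (+ 2 * n * s) * s + n * (s * s) ≡ n * (n * q) - n * (s * s)
    collect = solve-∀
    expand : ∑ n (λ i → (+ n * f i - s) * (+ n * f i - s)) ≡ + n * (+ n * q) - + n * (s * s)
    expand = begin
      ∑ n (λ i → (+ n * f i - s) * (+ n * f i - s))
        ≡⟨ ∑-cong′ n (λ i → square (+ n) (f i) s) ⟩
      ∑ n (λ i → + n * + n * (f i * f i) - c * f i + s * s)
        ≡⟨ ∑-+ n (λ i → + n * + n * (f i * f i) - c * f i) (λ _ → s * s) ⟩
      ∑ n (λ i → + n * + n * (f i * f i) - c * f i) + ∑ n (λ _ → s * s)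
        ≡⟨ cong₂ _+_ (∑-minus n (λ i → + n * + n * (f i * f i)) (λ i → c * f i)) (∑-const n (s * s)) ⟩
      ∑ n (λ i → + n * + n * (f i * f i)) - ∑ n (λ i → c * f i) + + n * (s * s)
        ≡⟨ cong₂ (λ a b → a - b + + n * (s * s)) (∑-* n (+ n * + n) (λ i → f i * f i)) (∑-* n c f) ⟩
      + n * + n * q - c * s + + n * (s * s)
        ≡⟨ collect (+ n) s q ⟩
      + n * (+ n * q) - + n * (s * s) ∎

  ∑-positive : ∀ n {f} → 0ℤ < ∑ n f → ∃[ i ] i ℕ.< n × 0ℤ < f i
  ∑-positive zero {f} 0<∑ = contradiction 0<∑ (<-irrefl (sym (∑-zero f)))
  ∑-positive (suc n) {f} 0<∑ with 0ℤ <? f 0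
  ... | yes 0<f0 = 0 , ℕ.z<s , 0<f0
  ... | no  0≮f0 with ∑-positive n {λ i → f (suc i)} (<-≤-trans (subst (0ℤ <_) (∑-suc n f) 0<∑)
                        (subst (f 0 + ∑ n (λ i → f (suc i)) ≤_) (+-identityˡ _) (+-monoˡ-≤ _ (≮⇒≥ 0≮f0))))
  ...   | i , i<n , 0<fi = suc i , s≤s i<n , 0<fi

module Powers where

  open import Data.Nat.Base
  open import Data.Nat.Tactic.RingSolver using (solve-∀)
  open import Relation.Binary.PropositionalEquality

  ^-distribʳ-* : ∀ x y n → (x * y) ^ n ≡ x ^ n * y ^ n
  ^-distribʳ-* x y zero    = refl
  ^-distribʳ-* x y (suc n) = trans (cong (x * y *_) (^-distribʳ-* x y n)) (interchange x y (x ^ n) (y ^ n))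
    where
    interchange : ∀ a b c d → a * b * (c * d) ≡ a * c * (b * d)
    interchange = solve-∀

-- Differences of naturals in ℤ, linking congruence and divisibility.

module Cast where

  open import Data.Nat.Base as ℕ using (ℕ; suc)
  open import Data.Integer.Base hiding (suc)
  open import Data.Integer.Properties
  open import Data.Integer.Tactic.RingSolver using (solve-∀)
  open import Relation.Binary.PropositionalEquality

  difference : ∀ a b k p → + a - + b ≡ + k * + p → a ≡ b ℕ.+ k ℕ.* p
  difference a b k p eq = +-injective (begin
    + a                    ≡⟨ split (+ a) (+ b) ⟩
    + b + (+ a - + b)      ≡⟨ cong (_+_ (+ b)) (trans eq (sym (pos-* k p))) ⟩
    + (b ℕ.+ k ℕ.* p)      ∎)
    where
    open ≡-Reasoning
    split : ∀ a b → a ≡ b + (a - b)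
    split = solve-∀

  negate : ∀ a b k p → + a - + b ≡ -[1+ k ] * + p → + b - + a ≡ + suc k * + p
  negate a b k p eq = begin
    + b - + a              ≡⟨ flip (+ b) (+ a) ⟩
    - (+ a - + b)          ≡⟨ cong -_ eq ⟩
    - (-[1+ k ] * + p)     ≡⟨ neg-distribˡ-* -[1+ k ] (+ p) ⟩
    + suc k * + p          ∎
    where
    open ≡-Reasoning
    flip : ∀ a b → a - b ≡ - (b - a)
    flip = solve-∀

  quotients : ∀ a b r s t p → a ≡ r ℕ.+ s ℕ.* p → b ≡ r ℕ.+ t ℕ.* p → + a - + b ≡ (+ s - + t) * + p
  quotients a b r s t p refl refl =
    trans (cong₂ (λ x y → + r + x - (+ r + y)) (pos-* s p) (pos-* t p)) (lemma (+ r) (+ s) (+ t) (+ p))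
    where
    lemma : ∀ r s t p → r + s * p - (r + t * p) ≡ (s - t) * p
    lemma = solve-∀

-- Congruence modulo the prime p.

module Residues (M : ℕ) (p-prime : Prime (suc M)) where

  open import Data.Nat.Base
  open import Data.Nat.Properties
  open import Data.Nat.DivMod
  open import Data.Nat.Divisibility
  open import Data.Nat.Coprimality using (coprime-Bézout; prime⇒coprime)
  open import Data.Nat.GCD using (module Bézout; GCD)
  open import Data.Nat.Primality using (Prime; prime⇒nonTrivial; euclidsLemma)
  open import Data.Nat.Tactic.RingSolver using (solve-∀)
  open import Data.Product.Base using (∃-syntax; _,_)
  open import Relation.Binary.Bundles using (Setoid)
  open import Relation.Nullary using (¬_; Dec; contradiction)
  open import Relation.Nullary.Decidable using (map′)
  open import Relation.Binary.PropositionalEquality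
  open import Data.Sum.Base as Sum using (_⊎_)
  open import Level using (0ℓ)
  import Data.Integer.Base as ℤ
  import Data.Integer.Properties as ℤ
  import Data.Integer.Divisibility.Signed as ℤ

  open Powers public

  p : ℕ
  p = suc M

  infix 4 _≈_ _≈?_

  -- A record instead of a bare equation between remainders: `a` and `b` can be inferred from
  -- `a ≈ b`, whereas `a % p` does not determine `a`.
  record _≈_ (a b : ℕ) : Set where
    constructor mk≈
    field %≡ : a % p ≡ b % p

  open _≈_ public

  opaque

    _≈?_ : ∀ a b → Dec (a ≈ b)
    a ≈? b = map′ mk≈ %≡ (a % p ≟ b % p)

  ≈-refl : ∀ {a} → a ≈ a
  ≈-refl = mk≈ refl

  ≈-sym : ∀ {a b} → a ≈ b → b ≈ a
  ≈-sym (mk≈ e) = mk≈ (sym e)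

  ≈-trans : ∀ {a b c} → a ≈ b → b ≈ c → a ≈ c
  ≈-trans (mk≈ e) (mk≈ f) = mk≈ (trans e f)

  ≈-setoid : Setoid 0ℓ 0ℓ
  ≈-setoid = record { _≈_ = _≈_ ; isEquivalence = record { refl = ≈-refl ; sym = ≈-sym ; trans = ≈-trans } }

  ≡⇒≈ : ∀ {a b} → a ≡ b → a ≈ b
  ≡⇒≈ refl = ≈-refl

  +-cong≈ : ∀ {a b c d} → a ≈ b → c ≈ d → a + c ≈ b + d
  +-cong≈ {a} {b} {c} {d} (mk≈ e) (mk≈ f) =
    mk≈ (trans (%-distribˡ-+ a c p) (trans (cong₂ (λ x y → (x + y) % p) e f) (sym (%-distribˡ-+ b d p))))

  *-cong≈ : ∀ {a b c d} → a ≈ b → c ≈ d → a * c ≈ b * d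
  *-cong≈ {a} {b} {c} {d} (mk≈ e) (mk≈ f) =
    mk≈ (trans (%-distribˡ-* a c p) (trans (cong₂ (λ x y → (x * y) % p) e f) (sym (%-distribˡ-* b d p))))

  ^-cong≈ : ∀ {a b} n → a ≈ b → a ^ n ≈ b ^ n
  ^-cong≈ zero    a≈b = ≈-refl
  ^-cong≈ (suc n) a≈b = *-cong≈ a≈b (^-cong≈ n a≈b)

  %-≈ : ∀ a → a % p ≈ a
  %-≈ a = mk≈ (m%n%n≡m%n a p)

  +*p≈ : ∀ a k → a + k * p ≈ a
  +*p≈ a k = mk≈ ([m+kn]%n≡m%n a k p)

  open import Relation.Binary.Reasoning.Setoid ≈-setoid

  ≈-< : ∀ {a b} → a < p → b < p → a ≈ b → a ≡ b
  ≈-< a<p b<p (mk≈ e) = trans (sym (m<n⇒m%n≡m a<p)) (trans e (m<n⇒m%n≡m b<p))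

  1<p : 1 < p
  1<p = nonTrivial⇒n>1 p {{prime⇒nonTrivial p-prime}}

  1≉0 : ¬ 1 ≈ 0
  1≉0 e = contradiction (≈-< 1<p z<s e) λ ()

  inverse : ∀ c → ¬ c ≈ 0 → ∃[ d ] d * c ≈ 1
  inverse c c≉0 with c % p in c%p≡
  ... | zero  = contradiction (mk≈ c%p≡) c≉0
  ... | r@(suc _) = go (coprime-Bézout (prime⇒coprime p-prime (subst (_< p) c%p≡ (m%n<n c p))))
    where
    c≈r : c ≈ r
    c≈r = ≈-trans (≈-sym (%-≈ c)) (≡⇒≈ c%p≡)
    rearrange : ∀ y r m → y * m * r + (1 + y * r) ≡ 1 + y * r * suc m
    rearrange = solve-∀
    go : Bézout.Identity 1 p r → ∃[ d ] d * c ≈ 1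
    go (Bézout.-+ x y 1+xp≡yr) = y , (begin
      y * c      ≈⟨ *-cong≈ (≈-refl {y}) c≈r ⟩
      y * r      ≡⟨ 1+xp≡yr ⟨
      1 + x * p  ≈⟨ +*p≈ 1 x ⟩
      1          ∎)
    -- Here y r is -1, so the inverse is -y; as M is -1 modulo p, it is represented in ℕ by `y * M`.
    go (Bézout.+- x y 1+yr≡xp) = y * M , (begin
      y * M * c              ≈⟨ *-cong≈ (≈-refl {y * M}) c≈r ⟩
      y * M * r              ≈⟨ +*p≈ (y * M * r) x ⟨
      y * M * r + x * p      ≡⟨ cong (y * M * r +_) 1+yr≡xp ⟨
      y * M * r + (1 + y * r) ≡⟨ rearrange y r M ⟩
      1 + y * r * p          ≈⟨ +*p≈ 1 (y * r) ⟩
      1                      ∎)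

  *-cancelʳ-≈ : ∀ {a b} c → ¬ c ≈ 0 → a * c ≈ b * c → a ≈ b
  *-cancelʳ-≈ {a} {b} c c≉0 ac≈bc with inverse c c≉0
  ... | d , dc≈1 = begin
    a            ≡⟨ *-identityʳ a ⟨
    a * 1        ≈⟨ *-cong≈ (≈-refl {a}) dc≈1 ⟨
    a * (d * c)  ≡⟨ swap a d c ⟩
    a * c * d    ≈⟨ *-cong≈ ac≈bc (≈-refl {d}) ⟩
    b * c * d    ≡⟨ swap b d c ⟨
    b * (d * c)  ≈⟨ *-cong≈ (≈-refl {b}) dc≈1 ⟩
    b * 1        ≡⟨ *-identityʳ b ⟩
    b            ∎
    where
    swap : ∀ a d c → a * (d * c) ≡ a * c * d
    swap = solve-∀

  *-≉0 : ∀ {a b} → ¬ a ≈ 0 → ¬ b ≈ 0 → ¬ a * b ≈ 0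
  *-≉0 {a} {b} a≉0 b≉0 ab≈0 = a≉0 (*-cancelʳ-≈ b b≉0 ab≈0)

  ^-≉0 : ∀ {a} n → ¬ a ≈ 0 → ¬ a ^ n ≈ 0
  ^-≉0     zero    a≉0 = 1≉0
  ^-≉0 {a} (suc n) a≉0 = *-≉0 a≉0 (^-≉0 n a≉0)

  suc-≉0 : ∀ {a} → a < M → ¬ suc a ≈ 0
  suc-≉0 a<M e = contradiction (≈-< (s≤s a<M) z<s e) λ ()

  ∣⇒≈ : ∀ {a b} → ℤ.+ p ℤ.∣ ℤ.+ a ℤ.- ℤ.+ b → a ≈ b
  ∣⇒≈ {a} {b} (ℤ.divides (ℤ.+ k) eq) = ≈-trans (≡⇒≈ (Cast.difference a b k p eq)) (+*p≈ b k)
  ∣⇒≈ {a} {b} (ℤ.divides ℤ.-[1+ k ] eq) = ≈-sym (≈-trans (≡⇒≈ (Cast.difference b a (suc k) p (Cast.negate a b k p eq))) (+*p≈ a (suc k)))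

  ≈⇒∣ : ∀ {a b} → a ≈ b → ℤ.+ p ℤ.∣ ℤ.+ a ℤ.- ℤ.+ b
  ≈⇒∣ {a} {b} (mk≈ e) = ℤ.divides (ℤ.+ (a / p) ℤ.- ℤ.+ (b / p))
    (Cast.quotients a b (a % p) (a / p) (b / p) p (m≡m%n+[m/n]*n a p) (trans (m≡m%n+[m/n]*n b p) (cong (_+ b / p * p) (sym e))))

  ∣-* : ∀ i j → ℤ.+ p ℤ.∣ i ℤ.* j → (ℤ.+ p ℤ.∣ i) ⊎ (ℤ.+ p ℤ.∣ j)
  ∣-* i j p∣ij = Sum.map ℤ.∣ᵤ⇒∣ ℤ.∣ᵤ⇒∣ (euclidsLemma ℤ.∣ i ∣ ℤ.∣ j ∣ p-prime (subst (p ∣_) (ℤ.abs-* i j) (ℤ.∣⇒∣ᵤ p∣ij)))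

  ≈1-* : ∀ x {m} k → x ^ m ≈ 1 → x ^ (k * m) ≈ 1
  ≈1-* x {m} k xm≈1 = begin
    x ^ (k * m)  ≡⟨ cong (x ^_) (*-comm k m) ⟩
    x ^ (m * k)  ≡⟨ ^-*-assoc x m k ⟨
    (x ^ m) ^ k  ≈⟨ ^-cong≈ k xm≈1 ⟩
    1 ^ k        ≡⟨ ^-zeroˡ k ⟩
    1            ∎

  -- Bézout's identity over ℕ reads d + i m = j n, or the same with m and n exchanged. So x^d times
  -- a power congruent to 1 is again a power congruent to 1.
  ≈1-gcd : ∀ x {m n d} → ¬ x ≈ 0 → x ^ m ≈ 1 → x ^ n ≈ 1 → GCD m n d → x ^ d ≈ 1
  ≈1-gcd x {m} {n} {d} x≉0 xm≈1 xn≈1 g = go (Bézout.identity g)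
    where
    cancel : ∀ {i j} → x ^ i ≈ 1 → x ^ j ≈ 1 → d + i ≡ j → x ^ d ≈ 1
    cancel {i} {j} xi≈1 xj≈1 d+i≡j = begin
      x ^ d          ≡⟨ *-identityʳ _ ⟨
      x ^ d * 1      ≈⟨ *-cong≈ (≈-refl {x ^ d}) xi≈1 ⟨
      x ^ d * x ^ i  ≡⟨ ^-distribˡ-+-* x d i ⟨
      x ^ (d + i)    ≡⟨ cong (x ^_) d+i≡j ⟩
      x ^ j          ≈⟨ xj≈1 ⟩
      1              ∎
    go : Bézout.Identity d m n → x ^ d ≈ 1
    go (Bézout.+- i j eq) = cancel (≈1-* x j xn≈1) (≈1-* x i xm≈1) eq
    go (Bézout.-+ i j eq) = cancel (≈1-* x i xm≈1) (≈1-* x j xn≈1) eq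

-- Monic integer polynomials.

module Monic where

  open import Data.Nat.Base as ℕ using (ℕ; zero; suc)
  import Data.Nat.Properties as ℕ
  open import Data.Integer.Base hiding (suc)
  open import Data.Integer.Properties
  open import Data.Integer.Tactic.RingSolver using (solve-∀)
  open import Data.List.Base using (List; []; _∷_; _++_; replicate; length)
  open import Data.List.Properties using (length-++; length-replicate)
  open import Relation.Binary.PropositionalEquality

  -- The coefficient list c₀ ∷ … ∷ cₙ₋₁ ∷ [] stands for the monic polynomial c₀ + … + cₙ₋₁ xⁿ⁻¹ + xⁿ.
  eval : List ℤ → ℤ → ℤ
  eval []       x = 1ℤ
  eval (c ∷ cs) x = c + x * eval cs x

  -- Horner's scheme: the coefficients of (f(x) - f(a))/(x - a) are the values at a of the tails of
  -- f. The quotient is again monic, its leading 1 staying implicit.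
  quotientBy : ℤ → List ℤ → List ℤ
  quotientBy a []           = []
  quotientBy a (c ∷ [])     = []
  quotientBy a (c ∷ d ∷ cs) = eval (d ∷ cs) a ∷ quotientBy a (d ∷ cs)

  length-quotientBy : ∀ a c cs → length (quotientBy a (c ∷ cs)) ≡ length cs
  length-quotientBy a c []       = refl
  length-quotientBy a c (d ∷ cs) = cong ℕ.suc (length-quotientBy a d cs)

  factor : ∀ a c cs x → eval (c ∷ cs) x - eval (c ∷ cs) a ≡ (x - a) * eval (quotientBy a (c ∷ cs)) x
  factor a c [] x = lemma a c x
    where
    lemma : ∀ a c x → c + x * 1ℤ - (c + a * 1ℤ) ≡ (x - a) * 1ℤ
    lemma = solve-∀
  factor a c (d ∷ cs) x = begin
    c + x * Ex - (c + a * Ea)             ≡⟨ expand a c x Ex Ea ⟩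
    (x - a) * Ea + x * (Ex - Ea)          ≡⟨ cong (λ y → (x - a) * Ea + x * y) (factor a d cs x) ⟩
    (x - a) * Ea + x * ((x - a) * Q)      ≡⟨ collect a x Ea Q ⟩
    (x - a) * (Ea + x * Q)                ∎
    where
    open ≡-Reasoning
    Ex = eval (d ∷ cs) x
    Ea = eval (d ∷ cs) a
    Q  = eval (quotientBy a (d ∷ cs)) x
    expand : ∀ a c x Ex Ea → c + x * Ex - (c + a * Ea) ≡ (x - a) * Ea + x * (Ex - Ea)
    expand = solve-∀
    collect : ∀ a x Ea Q → (x - a) * Ea + x * ((x - a) * Q) ≡ (x - a) * (Ea + x * Q)
    collect = solve-∀

  eval-replicate : ∀ n cs x → eval (replicate n 0ℤ ++ cs) (+ x) ≡ + (x ℕ.^ n) * eval cs (+ x)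
  eval-replicate zero    cs x = sym (*-identityˡ _)
  eval-replicate (suc n) cs x = begin
    0ℤ + + x * eval (replicate n 0ℤ ++ cs) (+ x)  ≡⟨ +-identityˡ _ ⟩
    + x * eval (replicate n 0ℤ ++ cs) (+ x)       ≡⟨ cong (_*_ (+ x)) (eval-replicate n cs x) ⟩
    + x * (+ (x ℕ.^ n) * eval cs (+ x))           ≡⟨ *-assoc (+ x) (+ (x ℕ.^ n)) _ ⟨
    + x * + (x ℕ.^ n) * eval cs (+ x)             ≡⟨ cong (_* eval cs (+ x)) (pos-* x (x ℕ.^ n)) ⟨
    + (x ℕ.^ suc n) * eval cs (+ x)               ∎
    where open ≡-Reasoning

  power-1 : ℕ → List ℤ
  power-1 n = -1ℤ ∷ (replicate n 0ℤ ++ [])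

  eval-power-1 : ∀ n x → eval (power-1 n) (+ x) ≡ + (x ℕ.^ suc n) - + 1
  eval-power-1 n x = begin
    -1ℤ + + x * eval (replicate n 0ℤ ++ []) (+ x) ≡⟨ cong (λ y → -1ℤ + + x * y) (trans (eval-replicate n [] x) (*-identityʳ _)) ⟩
    -1ℤ + + x * + (x ℕ.^ n)                       ≡⟨ cong (_+_ -1ℤ) (pos-* x (x ℕ.^ n)) ⟨
    -1ℤ + + (x ℕ.^ suc n)                         ≡⟨ +-comm -1ℤ (+ (x ℕ.^ suc n)) ⟩
    + (x ℕ.^ suc n) - + 1                         ∎
    where open ≡-Reasoning

  length-power-1 : ∀ n → length (power-1 n) ≡ suc n
  length-power-1 n = cong ℕ.suc (trans (length-++ (replicate n 0ℤ)) (trans (cong (ℕ._+ 0) (length-replicate n)) (ℕ.+-identityʳ n)))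

  -- 1 + xᵉ + … + xᵏᵉ for e = suc n
  geometric : ℕ → ℕ → List ℤ
  geometric n zero    = []
  geometric n (suc k) = 1ℤ ∷ (replicate n 0ℤ ++ geometric n k)

  length-geometric : ∀ n k → length (geometric n k) ≡ k ℕ.* suc n
  length-geometric n zero    = refl
  length-geometric n (suc k) = cong ℕ.suc (trans (length-++ (replicate n 0ℤ)) (cong₂ ℕ._+_ (length-replicate n) (length-geometric n k)))

  eval-geometric : ∀ n k x → (+ (x ℕ.^ suc n) - + 1) * eval (geometric n k) (+ x) ≡ + (x ℕ.^ (suc k ℕ.* suc n)) - + 1
  eval-geometric n zero    x = trans (*-identityʳ _) (cong (λ e → + (x ℕ.^ e) - + 1) (sym (ℕ.+-identityʳ (suc n))))
  eval-geometric n (suc k) x = begin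
    (X - + 1) * (1ℤ + + x * eval (replicate n 0ℤ ++ geometric n k) (+ x))
      ≡⟨ cong (λ y → (X - + 1) * (1ℤ + y)) (trans (cong (_*_ (+ x)) (eval-replicate n _ x)) (trans (sym (*-assoc (+ x) (+ (x ℕ.^ n)) E)) (cong (_* E) (sym (pos-* x (x ℕ.^ n)))))) ⟩
    (X - + 1) * (1ℤ + X * E)
      ≡⟨ expand X E ⟩
    X - + 1 + X * ((X - + 1) * E)
      ≡⟨ cong (λ y → X - + 1 + X * y) (eval-geometric n k x) ⟩
    X - + 1 + X * (+ (x ℕ.^ (suc k ℕ.* suc n)) - + 1)
      ≡⟨ collect X _ ⟩
    X * + (x ℕ.^ (suc k ℕ.* suc n)) - + 1
      ≡⟨ cong (_- + 1) (trans (sym (pos-* (x ℕ.^ suc n) _)) (cong +_ (sym (ℕ.^-distribˡ-+-* x (suc n) (suc k ℕ.* suc n))))) ⟩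
    + (x ℕ.^ (suc (suc k) ℕ.* suc n)) - + 1 ∎
    where
    open ≡-Reasoning
    X = + (x ℕ.^ suc n)
    E = eval (geometric n k) (+ x)
    expand : ∀ X E → (X - + 1) * (1ℤ + X * E) ≡ X - + 1 + X * ((X - + 1) * E)
    expand = solve-∀
    collect : ∀ X Y → X - + 1 + X * (Y - + 1) ≡ X * Y - + 1
    collect = solve-∀

-- Indicator functions with values in ℤ.

module Indicator where

  open import Data.Nat.Base using (ℕ; zero; suc)
  open import Data.Integer.Base hiding (suc)
  open import Data.Integer.Properties
  open import Data.List.Base using (filter; downFrom; length)
  open import Relation.Nullary using (Dec; yes; no; ¬_; ¬?; _×-dec_; contradiction)
  open import Relation.Unary using (Decidable; Pred)
  open import Relation.Binary.PropositionalEquality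
  open import Level using (0ℓ)
  open Sums

  𝟙 : ∀ {A : Set} → Dec A → ℤ
  𝟙 (yes _) = 1ℤ
  𝟙 (no  _) = 0ℤ

  𝟙-yes : ∀ {A : Set} (a? : Dec A) → A → 𝟙 a? ≡ 1ℤ
  𝟙-yes (yes _) a = refl
  𝟙-yes (no ¬a) a = contradiction a ¬a

  𝟙-no : ∀ {A : Set} (a? : Dec A) → ¬ A → 𝟙 a? ≡ 0ℤ
  𝟙-no (yes a) ¬a = contradiction a ¬a
  𝟙-no (no  _) ¬a = refl

  𝟙-cong : ∀ {A B : Set} (a? : Dec A) (b? : Dec B) → (A → B) → (B → A) → 𝟙 a? ≡ 𝟙 b?
  𝟙-cong (yes a) b? f g = sym (𝟙-yes b? (f a))
  𝟙-cong (no ¬a) b? f g = sym (𝟙-no b? (λ b → ¬a (g b)))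

  𝟙-idem : ∀ {A : Set} (a? : Dec A) → 𝟙 a? * 𝟙 a? ≡ 𝟙 a?
  𝟙-idem (yes _) = refl
  𝟙-idem (no  _) = refl

  𝟙-split : ∀ {A B : Set} (a? : Dec A) (b? : Dec B) → (A → ¬ B) → 𝟙 a? + 𝟙 (¬? b? ×-dec ¬? a?) ≡ 𝟙 (¬? b?)
  𝟙-split (yes a) (yes b) A⇒¬B = contradiction b (A⇒¬B a)
  𝟙-split (yes a) (no ¬b) A⇒¬B = refl
  𝟙-split (no ¬a) (yes b) A⇒¬B = refl
  𝟙-split (no ¬a) (no ¬b) A⇒¬B = refl

  𝟙-* : ∀ {A B C : Set} (a? : Dec A) (b? : Dec B) (c? : Dec C) → (C → A) → (C → B) → (A → B → C) → 𝟙 c? ≡ 𝟙 a? * 𝟙 b?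
  𝟙-* (yes a) (yes b) c? C⇒A C⇒B AB⇒C = 𝟙-yes c? (AB⇒C a b)
  𝟙-* (yes a) (no ¬b) c? C⇒A C⇒B AB⇒C = 𝟙-no c? (λ c → ¬b (C⇒B c))
  𝟙-* (no ¬a) b?      c? C⇒A C⇒B AB⇒C = trans (𝟙-no c? (λ c → ¬a (C⇒A c))) (sym (*-zeroˡ (𝟙 b?)))

  𝟙≤1 : ∀ {A : Set} (a? : Dec A) → 𝟙 a? ≤ 1ℤ
  𝟙≤1 (yes _) = ≤-refl
  𝟙≤1 (no  _) = +≤+ Data.Nat.Base.z≤n

  0≤𝟙 : ∀ {A : Set} (a? : Dec A) → 0ℤ ≤ 𝟙 a?
  0≤𝟙 (yes _) = +≤+ Data.Nat.Base.z≤n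
  0≤𝟙 (no  _) = ≤-refl

  ∑-𝟙 : ∀ n {P : Pred ℕ 0ℓ} (P? : Decidable P) → ∑ n (λ i → 𝟙 (P? i)) ≡ + length (filter P? (downFrom n))
  ∑-𝟙 zero    P? = ∑-zero _
  ∑-𝟙 (suc n) P? = trans (∑-snoc n _) (trans (cong (_+ 𝟙 (P? n)) (∑-𝟙 n P?)) step)
    where
    step : + length (filter P? (downFrom n)) + 𝟙 (P? n) ≡ + length (filter P? (downFrom (suc n)))
    step with P? n
    ... | yes _ = +-comm (+ length (filter P? (downFrom n))) 1ℤ
    ... | no  _ = +-identityʳ (+ length (filter P? (downFrom n)))

-- Permuted sums, roots of polynomials and sizes of the subgroups modulo p.

module Subgroups (M : ℕ) (p-prime : Prime (suc M)) where

  open import Data.Nat.Base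
  open import Data.Nat.Properties
  open import Data.Nat.DivMod
  open import Data.Nat.Tactic.RingSolver using (solve-∀)
  open import Data.Fin.Base using (Fin; toℕ; fromℕ<; zero; suc)
  open import Data.Fin.Properties using (toℕ<n; toℕ-fromℕ<; toℕ-injective)
  open import Data.Fin.Permutation using (Permutation′; permutation)
  open import Data.Product.Base using (_×_; _,_; proj₁; proj₂)
  open import Data.Sum.Base as Sum using (inj₁; inj₂)
  open import Data.List.Base using ([]; _∷_; length; filter; downFrom)
  open import Data.List.Relation.Unary.All as All using (All; []; _∷_)
  import Data.List.Relation.Unary.All.Properties as All
  open import Data.List.Relation.Unary.AllPairs using (AllPairs; []; _∷_)
  import Data.List.Relation.Unary.AllPairs.Properties as AllPairs
  open import Relation.Nullary using (¬_; contradiction; ¬?; _×-dec_)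
  open import Relation.Unary using (Decidable; Pred)
  open import Relation.Binary.PropositionalEquality hiding ([_])
  open import Level using (0ℓ)
  open import Data.Integer.Base as ℤ using (ℤ; +_; 0ℤ; 1ℤ)
  import Data.Integer.Properties as ℤ
  import Data.Integer.Divisibility.Signed as ℤ
  import Algebra.Properties.CommutativeMonoid.Sum *-1-commutativeMonoid as Π
  import Algebra.Properties.CommutativeMonoid.Sum ℤ.+-0-commutativeMonoid as Σ
  open Residues M p-prime
  open Sums
  open Monic
  open Indicator

  Periodic : (ℕ → ℤ) → Set
  Periodic f = ∀ {a b} → a ≈ b → f a ≡ f b

  module Scale (c : ℕ) (c≉0 : ¬ c ≈ 0) where

    multiply : ℕ → Fin p → Fin p
    multiply c i = fromℕ< (m%n<n (toℕ i * c) p)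

    toℕ-multiply : ∀ c i → toℕ (multiply c i) ≡ (toℕ i * c) % p
    toℕ-multiply c i = toℕ-fromℕ< (m%n<n (toℕ i * c) p)

    multiply-inverse : ∀ a b → a * b ≈ 1 → ∀ i → multiply b (multiply a i) ≡ i
    multiply-inverse a b ab≈1 i = toℕ-injective (≈-< (toℕ<n _) (toℕ<n i) (begin
      toℕ (multiply b (multiply a i))  ≡⟨ toℕ-multiply b (multiply a i) ⟩
      (toℕ (multiply a i) * b) % p     ≈⟨ %-≈ _ ⟩
      toℕ (multiply a i) * b           ≡⟨ cong (_* b) (toℕ-multiply a i) ⟩
      (toℕ i * a) % p * b              ≈⟨ *-cong≈ (%-≈ (toℕ i * a)) (≈-refl {b}) ⟩
      toℕ i * a * b                    ≡⟨ *-assoc (toℕ i) a b ⟩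
      toℕ i * (a * b)                  ≈⟨ *-cong≈ (≈-refl {toℕ i}) ab≈1 ⟩
      toℕ i * 1                        ≡⟨ *-identityʳ (toℕ i) ⟩
      toℕ i                            ∎))
      where open import Relation.Binary.Reasoning.Setoid ≈-setoid

    d : ℕ
    d = proj₁ (inverse c c≉0)

    dc≈1 : d * c ≈ 1
    dc≈1 = proj₂ (inverse c c≉0)

    scale : Permutation′ p
    scale = permutation (multiply c) (multiply d) (multiply-inverse d c dc≈1)
      (multiply-inverse c d (≈-trans (≡⇒≈ (*-comm c d)) dc≈1))

    ∑-scale : ∀ {f} → Periodic f → ∑ p (λ i → f (i * c)) ≡ ∑ p f
    ∑-scale {f} periodic = begin
      ∑ p (λ i → f (i * c))                    ≡⟨ ∑≡sum p _ ⟩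
      Σ.sum {p} (λ i → f (toℕ i * c))          ≡⟨ Σ.sum-cong-≗ {p} (λ i → periodic (≈-trans (≡⇒≈ (toℕ-multiply c i)) (%-≈ (toℕ i * c)))) ⟨
      Σ.sum {p} (λ i → f (toℕ (multiply c i))) ≡⟨ Σ.sum-permute {p} (λ i → f (toℕ i)) scale ⟨
      Σ.sum {p} (λ i → f (toℕ i))              ≡⟨ ∑≡sum p f ⟨
      ∑ p f                                    ∎
      where open ≡-Reasoning

    ∏-≈ : ∀ n (f g : Fin n → ℕ) → (∀ i → f i ≈ g i * c) → Π.sum f ≈ c ^ n * Π.sum g
    ∏-≈ zero    f g f≈gc = ≈-refl
    ∏-≈ (suc n) f g f≈gc = ≈-trans (*-cong≈ (f≈gc zero) (∏-≈ n (λ i → f (suc i)) (λ i → g (suc i)) (λ i → f≈gc (suc i))))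
      (≡⇒≈ (rearrange (g zero) c (c ^ n) (Π.sum (λ i → g (suc i)))))
      where
      rearrange : ∀ x c y z → x * c * (y * z) ≡ c * y * (x * z)
      rearrange = solve-∀

    ∏-≉0 : ∀ n (f : Fin n → ℕ) → (∀ i → ¬ f i ≈ 0) → ¬ Π.sum f ≈ 0
    ∏-≉0 zero    f f≉0 = 1≉0
    ∏-≉0 (suc n) f f≉0 = *-≉0 (f≉0 zero) (∏-≉0 n (λ i → f (suc i)) (λ i → f≉0 (suc i)))

    fermat : c ^ M ≈ 1
    fermat = *-cancelʳ-≈ Q (∏-≉0 M (λ j → suc (toℕ j)) (λ j → suc-≉0 (toℕ<n j))) (begin
      c ^ M * Q                                         ≈⟨ ∏-≈ M (λ j → g (toℕ (multiply c (suc j)))) (λ j → suc (toℕ j)) factors ⟨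
      Π.sum (λ (j : Fin M) → g (toℕ (multiply c (suc j)))) ≡⟨ *-identityˡ _ ⟨
      Π.sum (λ (i : Fin p) → g (toℕ (multiply c i)))    ≡⟨ Π.sum-permute {p} (λ i → g (toℕ i)) scale ⟨
      Π.sum (λ (i : Fin p) → g (toℕ i))                 ∎)
      where
      open import Relation.Binary.Reasoning.Setoid ≈-setoid
      -- The permutation acts on all residues and fixes 0. Replacing 0 by 1 turns the product over
      -- `Fin p` into the product of the units.
      g : ℕ → ℕ
      g zero    = 1
      g (suc i) = suc i
      g≡ : ∀ i → i ≢ 0 → g i ≡ i
      g≡ zero    i≢0 = contradiction refl i≢0
      g≡ (suc i) i≢0 = refl
      Q : ℕ
      Q = Π.sum (λ (j : Fin M) → suc (toℕ j))
      factors : ∀ j → g (toℕ (multiply c (suc j))) ≈ suc (toℕ j) * c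
      factors j = ≈-trans (≡⇒≈ (trans (g≡ _ nonzero) (toℕ-multiply c (suc j)))) (%-≈ _)
        where
        nonzero : toℕ (multiply c (suc j)) ≢ 0
        nonzero eq = *-≉0 (suc-≉0 (toℕ<n j)) c≉0 (mk≈ (trans (sym (toℕ-multiply c (suc j))) eq))

  open Scale using (∑-scale; fermat) public

  ∑-shift : ∀ {f} → Periodic f → ∀ t → ∑ p (λ i → f (i + t)) ≡ ∑ p f
  ∑-shift {f} periodic zero = ∑-cong′ p (λ i → cong f (+-identityʳ i))
  ∑-shift {f} periodic (suc t) = begin
    ∑ p (λ i → f (i + suc t))                    ≡⟨ ∑-cong′ p (λ i → cong f (+-suc i t)) ⟩
    ∑ p (λ i → f (suc i + t))                    ≡⟨ ∑-snoc M (λ i → f (suc i + t)) ⟩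
    ∑ M (λ i → f (suc i + t)) ℤ.+ f (p + t)      ≡⟨ cong (ℤ._+_ (∑ M (λ i → f (suc i + t)))) (periodic (≈-trans (≡⇒≈ (trans (+-comm p t) (cong (_+_ t) (sym (*-identityˡ p))))) (+*p≈ t 1))) ⟩
    ∑ M (λ i → f (suc i + t)) ℤ.+ f t            ≡⟨ ℤ.+-comm _ (f t) ⟩
    f t ℤ.+ ∑ M (λ i → f (suc i + t))            ≡⟨ ∑-suc M (λ i → f (i + t)) ⟨
    ∑ p (λ i → f (i + t))                        ≡⟨ ∑-shift periodic t ⟩
    ∑ p f                                        ∎
    where open ≡-Reasoning

  -- Lagrange's bound: a root r splits off x - r, and by Euclid's lemma any root incongruent to r is
  -- a root of the quotient. Monic polynomials cannot degenerate modulo p, and the recursion ends at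
  -- the constant 1, which has no root.
  roots-≤ : ∀ cs rs → AllPairs (λ r s → ¬ r ≈ s) rs → All (λ r → + p ℤ.∣ eval cs (+ r)) rs → length rs ≤ length cs
  roots-≤ cs       []       _              _        = z≤n
  roots-≤ []       (r ∷ rs) _              (p∣1 ∷ _) = contradiction (∣⇒≈ {1} {0} p∣1) 1≉0
  roots-≤ (c ∷ cs) (r ∷ rs) (r≉rs ∷ distinct) (p∣r ∷ p∣rs) = s≤s (subst (length rs ≤_) (length-quotientBy (+ r) c cs)
    (roots-≤ (quotientBy (+ r) (c ∷ cs)) rs distinct (All.zipWith root (r≉rs , p∣rs))))
    where
    root : ∀ {s} → ¬ r ≈ s × + p ℤ.∣ eval (c ∷ cs) (+ s) → + p ℤ.∣ eval (quotientBy (+ r) (c ∷ cs)) (+ s)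
    root {s} (r≉s , p∣s) with ∣-* (+ s ℤ.- + r) _ (subst (+ p ℤ.∣_) (factor (+ r) c cs (+ s)) (ℤ.∣m∣n⇒∣m-n p∣s p∣r))
    ... | inj₁ p∣s-r = contradiction (≈-sym (∣⇒≈ p∣s-r)) r≉s
    ... | inj₂ p∣q   = p∣q

  roots-count : ∀ cs {P : Pred ℕ 0ℓ} (P? : Decidable P) → (∀ x → P x → + p ℤ.∣ eval cs (+ x)) →
                ∑ p (λ x → 𝟙 (P? x)) ℤ.≤ + length cs
  roots-count cs P? root = subst (ℤ._≤ + length cs) (sym (∑-𝟙 p P?)) (ℤ.+≤+
    (roots-≤ cs (filter P? (downFrom p))
      (AllPairs.filter⁺ P? (AllPairs.applyDownFrom⁺₁ (λ x → x) p (λ j<i i<p e → <⇒≢ j<i (sym (≈-< i<p (<-trans j<i i<p) e)))))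
      (All.map (root _) (All.all-filter P? (downFrom p)))))

  χ : ℕ → ℕ → ℤ
  χ e x = 𝟙 (x ^ e ≈? 1)

  ε : ℕ → ℤ
  ε x = 𝟙 (¬? (x ≈? 0))

  ∑-ε : ∑ p ε ≡ + M
  ∑-ε = begin
    ∑ p ε                            ≡⟨ ∑-suc M ε ⟩
    ε 0 ℤ.+ ∑ M (λ i → ε (suc i))    ≡⟨ cong (ℤ._+ ∑ M (λ i → ε (suc i))) (𝟙-no (¬? (0 ≈? 0)) (λ 0≉0 → 0≉0 ≈-refl)) ⟩
    0ℤ ℤ.+ ∑ M (λ i → ε (suc i))     ≡⟨ ℤ.+-identityˡ _ ⟩
    ∑ M (λ i → ε (suc i))            ≡⟨ ∑-cong M (λ i i<M → 𝟙-yes (¬? (suc i ≈? 0)) (suc-≉0 i<M)) ⟩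
    ∑ M (λ _ → 1ℤ)                   ≡⟨ ∑-const M 1ℤ ⟩
    + M ℤ.* 1ℤ                       ≡⟨ ℤ.*-identityʳ (+ M) ⟩
    + M                              ∎
    where open ≡-Reasoning

  0^≉1 : ∀ {x} e → .{{NonZero e}} → x ≈ 0 → ¬ x ^ e ≈ 1
  0^≉1 {x} (suc e) x≈0 xe≈1 = 1≉0 (≈-trans (≈-sym xe≈1) (*-cong≈ x≈0 (≈-refl {x ^ e})))

  -- Both x^e - 1 and 1 + x^e + ... + x^((D-1)e) have at most as many roots as their degrees, e and
  -- (D - 1)e. By Fermat every unit is a root of one of them, and there are De units, so the first
  -- bound is attained.
  ∑-χ : ∀ D e → D * e ≡ M → ∑ p (χ e) ≡ + e
  ∑-χ zero    e       0≡M = contradiction (subst (λ m → 1 < suc m) (sym 0≡M) 1<p) λ { (s≤s ()) }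
  ∑-χ (suc k) zero    D*0≡M = contradiction (subst (λ m → 1 < suc m) (trans (sym D*0≡M) (*-zeroʳ k)) 1<p) λ { (s≤s ()) }
  ∑-χ (suc k) e@(suc n) De≡M = ℤ.≤-antisym h≤e e≤h
    where
    x^e? = λ x → x ^ e ≈? 1
    other? = λ x → ¬? (x ≈? 0) ×-dec ¬? (x^e? x)
    h≤e : ∑ p (χ e) ℤ.≤ + e
    h≤e = subst (λ l → ∑ p (χ e) ℤ.≤ + l) (length-power-1 n)
      (roots-count (power-1 n) x^e? (λ x xe≈1 → subst (+ p ℤ.∣_) (sym (eval-power-1 n x)) (≈⇒∣ xe≈1)))
    o≤ke : ∑ p (λ x → 𝟙 (other? x)) ℤ.≤ + (k * e)
    o≤ke = subst (λ l → ∑ p (λ x → 𝟙 (other? x)) ℤ.≤ + l) (length-geometric n k) (roots-count (geometric n k) other? root)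
      where
      root : ∀ x → ¬ x ≈ 0 × ¬ x ^ e ≈ 1 → + p ℤ.∣ eval (geometric n k) (+ x)
      root x (x≉0 , xe≉1) = Sum.[ (λ p∣xe-1 → contradiction (∣⇒≈ {x ^ e} {1} p∣xe-1) xe≉1) , (λ p∣G → p∣G) ]′
        (∣-* (+ (x ^ e) ℤ.- + 1) (eval (geometric n k) (+ x)) (subst (+ p ℤ.∣_) (sym (eval-geometric n k x)) (≈⇒∣ xM≈1)))
        where
        xM≈1 : x ^ (suc k * e) ≈ 1
        xM≈1 = subst (λ m → x ^ m ≈ 1) (sym De≡M) (fermat x x≉0)
    pointwise : ∀ x → χ e x ℤ.+ 𝟙 (other? x) ≡ ε x
    pointwise x = 𝟙-split (x^e? x) (x ≈? 0) (λ xe≈1 x≈0 → 0^≉1 e x≈0 xe≈1)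
    total : ∑ p (χ e) ℤ.+ ∑ p (λ x → 𝟙 (other? x)) ≡ + e ℤ.+ + (k * e)
    total = trans (sym (∑-+ p (χ e) _)) (trans (∑-cong′ p pointwise) (trans ∑-ε (cong +_ (sym De≡M))))
    e≤h : + e ℤ.≤ ∑ p (χ e)
    e≤h = ℤ.≮⇒≥ (λ h<e → ℤ.<-irrefl total (ℤ.+-mono-<-≤ h<e o≤ke))

-- The second moment over affine maps and the discrepancy bound.

module Variance (M : ℕ) (p-prime : Prime (suc M)) where

  open import Data.Nat.Base as ℕ using (ℕ; suc; _^_; NonZero; z≤n; s≤s)
  import Data.Nat.Properties as ℕ
  import Data.Nat.Tactic.RingSolver as ℕ
  open import Data.Integer.Base hiding (suc; _^_; NonZero)
  open import Data.Integer.Properties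
  open import Data.Integer.Tactic.RingSolver using (solve-∀)
  open import Relation.Nullary using (¬_; yes; no; contradiction; ¬?)
  open import Relation.Binary.Definitions using (tri<; tri≈; tri>)
  open import Relation.Binary.PropositionalEquality
  open Residues M p-prime
  open Subgroups M p-prime
  open Sums
  open Indicator

  module SecondMoment (F : ℕ → ℤ) (periodic : Periodic F) (∑F≡0 : ∑ p F ≡ 0ℤ) where

    F² : ℕ → ℤ
    F² x = F x * F x

    correlation : ℕ → ℕ → ℤ
    correlation v w = ∑ p (λ c → ∑ p (λ b → F (b ℕ.+ v ℕ.* c) * F (b ℕ.+ w ℕ.* c)))

    translate : ∀ {a b} t → a ≈ b → a ℕ.+ t ≈ b ℕ.+ t
    translate t a≈b = +-cong≈ a≈b (≈-refl {t})

    correlation-refl : ∀ v → correlation v v ≡ + p * ∑ p F²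
    correlation-refl v = begin
      ∑ p (λ c → ∑ p (λ b → F² (b ℕ.+ v ℕ.* c)))  ≡⟨ ∑-cong′ p (λ c → ∑-shift {F²} (λ a≈b → cong₂ _*_ (periodic a≈b) (periodic a≈b)) (v ℕ.* c)) ⟩
      ∑ p (λ c → ∑ p F²)                          ≡⟨ ∑-const p (∑ p F²) ⟩
      + p * ∑ p F²                                ∎
      where open ≡-Reasoning

    correlation-sym : ∀ v w → correlation v w ≡ correlation w v
    correlation-sym v w = ∑-cong′ p (λ c → ∑-cong′ p (λ b → *-comm (F (b ℕ.+ v ℕ.* c)) (F (b ℕ.+ w ℕ.* c))))

    -- Translating b by v c leaves F(b) F(b + c(k + 1)). For fixed b the argument b + c(k + 1) runs
    -- once through all residues with c, because k + 1 is a unit; so the sum over c is ∑ F = 0.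
    correlation-+ : ∀ v k → k ℕ.< M → correlation v (v ℕ.+ suc k) ≡ 0ℤ
    correlation-+ v k k<M = begin
      ∑ p (λ c → ∑ p (λ b → F (b ℕ.+ v ℕ.* c) * F (b ℕ.+ (v ℕ.+ suc k) ℕ.* c)))
        ≡⟨ ∑-cong′ p (λ c → ∑-cong′ p (λ b → cong (λ x → F (b ℕ.+ v ℕ.* c) * F x) (regroup b v (suc k) c))) ⟩
      ∑ p (λ c → ∑ p (λ b → F (b ℕ.+ v ℕ.* c) * F (b ℕ.+ v ℕ.* c ℕ.+ c ℕ.* suc k)))
        ≡⟨ ∑-cong′ p (λ c → ∑-shift {λ b → F b * F (b ℕ.+ c ℕ.* suc k)} (λ a≈b → cong₂ _*_ (periodic a≈b) (periodic (translate (c ℕ.* suc k) a≈b))) (v ℕ.* c)) ⟩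
      ∑ p (λ c → ∑ p (λ b → F b * F (b ℕ.+ c ℕ.* suc k)))
        ≡⟨ ∑-comm p p (λ c b → F b * F (b ℕ.+ c ℕ.* suc k)) ⟩
      ∑ p (λ b → ∑ p (λ c → F b * F (b ℕ.+ c ℕ.* suc k)))
        ≡⟨ ∑-cong′ p (λ b → trans (∑-* p (F b) (λ c → F (b ℕ.+ c ℕ.* suc k))) (trans (cong (_*_ (F b)) (inner b)) (*-zeroʳ (F b)))) ⟩
      ∑ p (λ b → 0ℤ)
        ≡⟨ trans (∑-const p 0ℤ) (*-zeroʳ (+ p)) ⟩
      0ℤ ∎
      where
      open ≡-Reasoning
      regroup : ∀ b v k c → b ℕ.+ (v ℕ.+ k) ℕ.* c ≡ b ℕ.+ v ℕ.* c ℕ.+ c ℕ.* k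
      regroup = ℕ.solve-∀
      inner : ∀ b → ∑ p (λ c → F (b ℕ.+ c ℕ.* suc k)) ≡ 0ℤ
      inner b = begin
        ∑ p (λ c → F (b ℕ.+ c ℕ.* suc k))  ≡⟨ ∑-scale (suc k) (suc-≉0 k<M) {λ x → F (b ℕ.+ x)} (λ x≈y → periodic (+-cong≈ (≈-refl {b}) x≈y)) ⟩
        ∑ p (λ x → F (b ℕ.+ x))            ≡⟨ ∑-cong′ p (λ x → cong F (ℕ.+-comm b x)) ⟩
        ∑ p (λ x → F (x ℕ.+ b))            ≡⟨ ∑-shift periodic b ⟩
        ∑ p F                              ≡⟨ ∑F≡0 ⟩
        0ℤ                                 ∎

    correlation-< : ∀ {v w} → v ℕ.< w → w ℕ.< p → correlation v w ≡ 0ℤ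
    correlation-< {v} {w} v<w w<p = subst (λ w → correlation v w ≡ 0ℤ) w≡
      (correlation-+ v (w ℕ.∸ suc v) (ℕ.≤-trans (ℕ.∸-monoʳ-< (s≤s z≤n) v<w) (ℕ.≤-pred w<p)))
      where
      w≡ : v ℕ.+ suc (w ℕ.∸ suc v) ≡ w
      w≡ = trans (ℕ.+-suc v _) (ℕ.m+[n∸m]≡n v<w)

    correlation-≢ : ∀ {v w} → v ℕ.< p → w ℕ.< p → v ≢ w → correlation v w ≡ 0ℤ
    correlation-≢ {v} {w} v<p w<p v≢w with ℕ.<-cmp v w
    ... | tri< v<w _ _ = correlation-< v<w w<p
    ... | tri≈ _ v≡w _ = contradiction v≡w v≢w
    ... | tri> _ _ w<v = trans (correlation-sym v w) (correlation-< w<v v<p)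

    window : ℕ → ℕ → ℕ → ℤ
    window N c b = ∑ N (λ v → F (b ℕ.+ v ℕ.* c))

    secondMoment : ∀ N → N ℕ.≤ p → ∑ p (λ c → ∑ p (λ b → window N c b * window N c b)) ≡ + N * (+ p * ∑ p F²)
    secondMoment N N≤p = begin
      ∑ p (λ c → ∑ p (λ b → window N c b * window N c b))
        ≡⟨ ∑-cong′ p (λ c → trans (∑-cong′ p (λ b → ∑-*-∑ N _ _)) (trans (∑-comm p N _) (∑-cong′ N (λ v → ∑-comm p N (T c v))))) ⟩
      ∑ p (λ c → ∑ N (λ v → ∑ N (λ w → ∑ p (λ b → T c v b w))))
        ≡⟨ trans (∑-comm p N _) (∑-cong′ N (λ v → ∑-comm p N _)) ⟩
      ∑ N (λ v → ∑ N (λ w → correlation v w))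
        ≡⟨ ∑-diagonal N correlation (λ v w v<N w<N → correlation-≢ (ℕ.<-≤-trans v<N N≤p) (ℕ.<-≤-trans w<N N≤p)) ⟩
      ∑ N (λ v → correlation v v)
        ≡⟨ ∑-cong′ N correlation-refl ⟩
      ∑ N (λ v → + p * ∑ p F²)
        ≡⟨ ∑-const N _ ⟩
      + N * (+ p * ∑ p F²) ∎
      where
      open ≡-Reasoning
      T : ℕ → ℕ → ℕ → ℕ → ℤ
      T c v b w = F (b ℕ.+ v ℕ.* c) * F (b ℕ.+ w ℕ.* c)

    -- The terms with c ∈ H of the second moment all equal the term with c = 1.
    module Invariant (e : ℕ) (invariant : ∀ {c} x → c ^ e ≈ 1 → ¬ c ≈ 0 → F (x ℕ.* c) ≡ F x)
                     (subgroup≉0 : ∀ {c} → c ^ e ≈ 1 → ¬ c ≈ 0) where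

      Z : ℕ → ℕ → ℤ
      Z N c = ∑ p (λ b → window N c b * window N c b)

      Y : ℕ → ℕ → ℤ
      Y N u = ∑ N (λ v → F (u ℕ.+ v))

      Y² : ℕ → ℕ → ℤ
      Y² N u = Y N u * Y N u

      -- The substitution b = u c turns F(b + v c) into F((u + v) c), which is F(u + v) by
      -- invariance under H.
      Z-subgroup : ∀ N c → c ^ e ≈ 1 → Z N c ≡ ∑ p (Y² N)
      Z-subgroup N c ce≈1 = begin
        Z N c                                 ≡⟨ ∑-scale c (subgroup≉0 ce≈1) (λ a≈b → cong₂ _*_ (window-cong a≈b) (window-cong a≈b)) ⟨
        ∑ p (λ u → window N c (u ℕ.* c) * window N c (u ℕ.* c))
                                              ≡⟨ ∑-cong′ p (λ u → cong₂ _*_ (window-Y u) (window-Y u)) ⟩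
        ∑ p (Y² N)                            ∎
        where
        open ≡-Reasoning
        window-cong : ∀ {a b} → a ≈ b → window N c a ≡ window N c b
        window-cong a≈b = ∑-cong′ N (λ v → periodic (translate (v ℕ.* c) a≈b))
        window-Y : ∀ u → window N c (u ℕ.* c) ≡ Y N u
        window-Y u = ∑-cong′ N (λ v → trans (cong F (sym (ℕ.*-distribʳ-+ c u v))) (invariant (u ℕ.+ v) ce≈1 (subgroup≉0 ce≈1)))

      -- The c outside H contribute sums of squares to the second moment and are dropped.
      subgroup-moment : ∀ N → N ℕ.≤ p → ∑ p (χ e) * ∑ p (Y² N) ≤ + N * (+ p * ∑ p F²)
      subgroup-moment N N≤p = begin
        ∑ p (χ e) * ∑ p (Y² N)             ≡⟨ ∑-*ʳ p (∑ p (Y² N)) (χ e) ⟨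
        ∑ p (λ c → χ e c * ∑ p (Y² N))     ≤⟨ ∑-mono p (λ c _ → χ-* c) ⟩
        ∑ p (Z N)                          ≡⟨ secondMoment N N≤p ⟩
        + N * (+ p * ∑ p F²)               ∎
        where
        open ≤-Reasoning
        χ-* : ∀ c → χ e c * ∑ p (Y² N) ≤ Z N c
        χ-* c with c ^ e ≈? 1
        ... | yes ce≈1 = ≤-reflexive (trans (*-identityˡ (∑ p (Y² N))) (sym (Z-subgroup N c ce≈1)))
        ... | no  _    = ≤-trans (≤-reflexive (*-zeroˡ (∑ p (Y² N)))) (∑-nonNeg p (λ b → 0≤i*i (window N c b)))

      -- Of the p starting points only 1, ..., N are kept, the others adding squares; Cauchy-Schwarz
      -- over these then costs a factor N instead of p.
      interval-moment : ∀ N → N ℕ.≤ p → ∑ N (λ u → Y N (u ℕ.+ 1)) * ∑ N (λ u → Y N (u ℕ.+ 1)) ≤ + N * ∑ p (Y² N)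
      interval-moment N N≤p = ≤-trans (cauchy N (λ u → Y N (u ℕ.+ 1))) (*-monoˡ-≤-nonNeg (+ N) (≤-trans
        (∑-prefix N≤p (λ u → 0≤i*i (Y N (u ℕ.+ 1))))
        (≤-reflexive (∑-shift {Y² N} (λ a≈b → cong₂ _*_ (Y-cong a≈b) (Y-cong a≈b)) 1))))
        where
        Y-cong : ∀ {a b} → a ≈ b → Y N a ≡ Y N b
        Y-cong a≈b = ∑-cong′ N (λ v → periodic (translate v a≈b))

  -- A sum with triangular weights on 1, ..., 2N - 1. The offset 1 keeps 0 out of the range, and u
  -- supplies the starting points for Cauchy-Schwarz.
  Φ : ℕ → (ℕ → ℤ) → ℤ
  Φ N f = ∑ N (λ u → ∑ N (λ v → f (u ℕ.+ 1 ℕ.+ v)))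

  Φ-minus : ∀ N f g → Φ N (λ x → f x - g x) ≡ Φ N f - Φ N g
  Φ-minus N f g = trans (∑-cong′ N (λ u → ∑-minus N _ _)) (∑-minus N _ _)

  module Discrepancy (D e : ℕ) {{_ : NonZero e}} (De≡M : D ℕ.* e ≡ M) where

    m h : ℤ
    m = + M
    h = + e

    F : ℕ → ℤ
    F x = m * χ e x - h * ε x

    χ-cong : Periodic (χ e)
    χ-cong {a} {b} a≈b = 𝟙-cong _ _ (≈-trans (^-cong≈ e (≈-sym a≈b))) (≈-trans (^-cong≈ e a≈b))

    ε-cong : Periodic ε
    ε-cong {a} {b} a≈b = 𝟙-cong _ _ (λ a≉0 b≈0 → a≉0 (≈-trans a≈b b≈0)) (λ b≉0 a≈0 → b≉0 (≈-trans (≈-sym a≈b) a≈0))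

    periodic : Periodic F
    periodic a≈b = cong₂ (λ i j → m * i - h * j) (χ-cong a≈b) (ε-cong a≈b)

    subgroup≉0 : ∀ {c} → c ^ e ≈ 1 → ¬ c ≈ 0
    subgroup≉0 ce≈1 c≈0 = 0^≉1 e c≈0 ce≈1

    invariant : ∀ {c} x → c ^ e ≈ 1 → ¬ c ≈ 0 → F (x ℕ.* c) ≡ F x
    invariant {c} x ce≈1 c≉0 = cong₂ (λ i j → m * i - h * j)
      (𝟙-cong _ _ (≈-trans (≈-sym xc≈x)) (≈-trans xc≈x))
      (𝟙-cong _ _ (λ xc≉0 x≈0 → xc≉0 (*-cong≈ x≈0 (≈-refl {c}))) (λ x≉0 → *-≉0 x≉0 c≉0))
      where
      xc≈x : (x ℕ.* c) ^ e ≈ x ^ e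
      xc≈x = ≈-trans (≡⇒≈ (^-distribʳ-* x c e)) (≈-trans (*-cong≈ (≈-refl {x ^ e}) ce≈1) (≡⇒≈ (ℕ.*-identityʳ (x ^ e))))

    ∑-F : ∀ n → ∑ n F ≡ m * ∑ n (χ e) - h * ∑ n ε
    ∑-F n = trans (∑-minus n _ _) (cong₂ _-_ (∑-* n m (χ e)) (∑-* n h ε))

    ∑F≡0 : ∑ p F ≡ 0ℤ
    ∑F≡0 = trans (∑-F p) (trans (cong₂ (λ i j → m * i - h * j) (∑-χ D e De≡M) ∑-ε) (lemma m h))
      where
      lemma : ∀ m h → m * h - h * m ≡ 0ℤ
      lemma = solve-∀

    open SecondMoment F periodic ∑F≡0
    open Invariant e invariant subgroup≉0

    F²-expand : ∀ x → F² x ≡ (m * m - + 2 * m * h) * χ e x + h * h * ε x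
    F²-expand x = trans (square m h (χ e x) (ε x)) (trans
      (cong₂ (λ i j → m * m * i - + 2 * m * h * j + h * h * (ε x * ε x)) (𝟙-idem (x ^ e ≈? 1)) χε≡χ)
      (trans (cong (λ i → m * m * χ e x - + 2 * m * h * χ e x + h * h * i) (𝟙-idem (¬? (x ≈? 0)))) (collect m h (χ e x) (ε x))))
      where
      χε≡χ : χ e x * ε x ≡ χ e x
      χε≡χ with x ^ e ≈? 1
      ... | yes xe≈1 = trans (*-identityˡ (ε x)) (𝟙-yes (¬? (x ≈? 0)) (subgroup≉0 xe≈1))
      ... | no  _    = *-zeroˡ (ε x)
      square : ∀ m h i j → (m * i - h * j) * (m * i - h * j) ≡ m * m * (i * i) - + 2 * m * h * (i * j) + h * h * (j * j)
      square = solve-∀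
      collect : ∀ m h i j → m * m * i - + 2 * m * h * i + h * h * j ≡ (m * m - + 2 * m * h) * i + h * h * j
      collect = solve-∀

    ∑F² : ∑ p F² ≡ h * (m * m - m * h)
    ∑F² = begin
      ∑ p F²                                         ≡⟨ ∑-cong′ p F²-expand ⟩
      ∑ p (λ x → a * χ e x + h * h * ε x)            ≡⟨ ∑-+ p (λ x → a * χ e x) (λ x → h * h * ε x) ⟩
      ∑ p (λ x → a * χ e x) + ∑ p (λ x → h * h * ε x) ≡⟨ cong₂ _+_ (∑-* p a (χ e)) (∑-* p (h * h) ε) ⟩
      a * ∑ p (χ e) + h * h * ∑ p ε                  ≡⟨ cong₂ (λ i j → a * i + h * h * j) (∑-χ D e De≡M) ∑-ε ⟩
      a * h + h * h * m                              ≡⟨ collect m h ⟩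
      h * (m * m - m * h)                            ∎
      where
      open ≡-Reasoning
      a = m * m - + 2 * m * h
      collect : ∀ m h → (m * m - + 2 * m * h) * h + h * h * m ≡ h * (m * m - m * h)
      collect = solve-∀

    Φ-F : ∀ N → N ℕ.+ N ℕ.≤ p → Φ N F ≡ m * Φ N (χ e) - h * (+ N * + N)
    Φ-F N 2N≤p = begin
      Φ N F                              ≡⟨ ∑-cong′ N (λ u → trans (∑-minus N _ _) (cong₂ _-_ (∑-* N m _) (∑-* N h _))) ⟩
      ∑ N (λ u → m * A u - h * B u)      ≡⟨ trans (∑-minus N _ _) (cong₂ _-_ (∑-* N m A) (∑-* N h B)) ⟩
      m * Φ N (χ e) - h * Φ N ε          ≡⟨ cong (λ i → m * Φ N (χ e) - h * i) Φ-ε ⟩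
      m * Φ N (χ e) - h * (+ N * + N)    ∎
      where
      open ≡-Reasoning
      A B : ℕ → ℤ
      A u = ∑ N (λ v → χ e (u ℕ.+ 1 ℕ.+ v))
      B u = ∑ N (λ v → ε (u ℕ.+ 1 ℕ.+ v))
      ε≡1 : ∀ u v → u ℕ.< N → v ℕ.< N → ε (u ℕ.+ 1 ℕ.+ v) ≡ 1ℤ
      ε≡1 u v u<N v<N = 𝟙-yes (¬? (_ ≈? 0)) (subst (λ x → ¬ x ≈ 0) (cong (ℕ._+ v) (ℕ.+-comm 1 u))
        (suc-≉0 (ℕ.≤-pred (subst (ℕ._≤ p) (cong suc (ℕ.+-suc u v)) (ℕ.≤-trans (ℕ.+-mono-≤ u<N v<N) 2N≤p)))))
      Φ-ε : Φ N ε ≡ + N * + N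
      Φ-ε = begin
        Φ N ε                        ≡⟨ ∑-cong N (λ u u<N → ∑-cong N (λ v v<N → ε≡1 u v u<N v<N)) ⟩
        ∑ N (λ u → ∑ N (λ v → 1ℤ))   ≡⟨ ∑-cong′ N (λ u → trans (∑-const N 1ℤ) (*-identityʳ (+ N))) ⟩
        ∑ N (λ u → + N)              ≡⟨ ∑-const N (+ N) ⟩
        + N * + N                    ∎

    discrepancy : ∀ N P → N ℕ.+ N ℕ.≤ p → p ℕ.≤ P ℕ.* P → ∣ m * Φ N (χ e) - h * (+ N * + N) ∣ ℕ.≤ N ℕ.* P ℕ.* M
    discrepancy N P 2N≤p p≤P² = square-cancel-≤ (drop‿+≤+ (begin
      + (∣ E ∣ ℕ.* ∣ E ∣)                          ≡⟨ i*i≡∣i∣*∣i∣ E ⟨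
      E * E                                        ≡⟨ cong (λ i → i * i) (Φ-F N 2N≤p) ⟨
      Φ N F * Φ N F                                ≤⟨ *-cancelˡ-≤-pos _ _ h {{positive-h}} scaled ⟩
      n * n * + p * (m * m - m * h)                ≤⟨ *-monoˡ-≤-nonNeg (n * n * + p) {{nonNeg-nnp}} mm-mh≤mm ⟩
      n * n * + p * (m * m)                        ≡⟨ cast ⟩
      + (N ℕ.* N ℕ.* p ℕ.* (M ℕ.* M))              ≤⟨ +≤+ (ℕ.*-monoˡ-≤ (M ℕ.* M) (ℕ.*-monoʳ-≤ (N ℕ.* N) p≤P²)) ⟩
      + (N ℕ.* N ℕ.* (P ℕ.* P) ℕ.* (M ℕ.* M))      ≡⟨ cong +_ (regroup N P M) ⟩
      + (N ℕ.* P ℕ.* M ℕ.* (N ℕ.* P ℕ.* M))        ∎))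
      where
      open ≤-Reasoning
      n E : ℤ
      n = + N
      E = m * Φ N (χ e) - h * (+ N * + N)
      positive-h : Positive h
      positive-h = positive {h} (+<+ (ℕ.>-nonZero⁻¹ e))
      regroup : ∀ N P M → N ℕ.* N ℕ.* (P ℕ.* P) ℕ.* (M ℕ.* M) ≡ N ℕ.* P ℕ.* M ℕ.* (N ℕ.* P ℕ.* M)
      regroup = ℕ.solve-∀
      i*i≡∣i∣*∣i∣ : ∀ i → i * i ≡ + (∣ i ∣ ℕ.* ∣ i ∣)
      i*i≡∣i∣*∣i∣ (+ k)    = sym (pos-* k k)
      i*i≡∣i∣*∣i∣ -[1+ k ] = refl
      square-cancel-≤ : ∀ {a b} → a ℕ.* a ℕ.≤ b ℕ.* b → a ℕ.≤ b
      square-cancel-≤ a²≤b² = ℕ.≮⇒≥ (λ b<a → ℕ.<⇒≱ (ℕ.*-mono-< b<a b<a) a²≤b²)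
      cast : n * n * + p * (m * m) ≡ + (N ℕ.* N ℕ.* p ℕ.* (M ℕ.* M))
      cast = trans (cong₂ _*_ (trans (cong (_* + p) (sym (pos-* N N))) (sym (pos-* (N ℕ.* N) p))) (sym (pos-* M M))) (sym (pos-* (N ℕ.* N ℕ.* p) (M ℕ.* M)))
      nonNeg-nnp : NonNegative (n * n * + p)
      nonNeg-nnp = subst NonNegative (trans (pos-* (N ℕ.* N) p) (cong (_* + p) (pos-* N N))) _
      mm-mh≤mm : m * m - m * h ≤ m * m
      mm-mh≤mm = ≤-trans (+-monoʳ-≤ (m * m) (neg-mono-≤ (subst (0ℤ ≤_) (pos-* M e) (+≤+ z≤n)))) (≤-reflexive (+-identityʳ (m * m)))
      swap : ∀ h n s → h * (n * s) ≡ n * (h * s)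
      swap = solve-∀
      collect : ∀ h n p k → n * (n * (p * (h * k))) ≡ h * (n * n * p * k)
      collect = solve-∀
      N≤p : N ℕ.≤ p
      N≤p = ℕ.≤-trans (ℕ.m≤m+n N N) 2N≤p
      -- The h elements c ∈ H on the left meet the factor h of ∑ F² on the right. Cancelling it
      -- leaves m² - mh ≤ m², so the final bound does not depend on D.
      scaled : h * (Φ N F * Φ N F) ≤ h * (n * n * + p * (m * m - m * h))
      scaled = begin
        h * (Φ N F * Φ N F)                        ≤⟨ *-monoˡ-≤-nonNeg h (interval-moment N N≤p) ⟩
        h * (n * ∑ p (Y² N))                       ≡⟨ swap h n (∑ p (Y² N)) ⟩
        n * (h * ∑ p (Y² N))                       ≡⟨ cong (λ i → n * (i * ∑ p (Y² N))) (∑-χ D e De≡M) ⟨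
        n * (∑ p (χ e) * ∑ p (Y² N))               ≤⟨ *-monoˡ-≤-nonNeg n (subgroup-moment N N≤p) ⟩
        n * (n * (+ p * ∑ p F²))                   ≡⟨ cong (λ i → n * (n * (+ p * i))) ∑F² ⟩
        n * (n * (+ p * (h * (m * m - m * h))))    ≡⟨ collect h n (+ p) (m * m - m * h) ⟩
        h * (n * n * + p * (m * m - m * h))        ∎

-- Lists of distinct prime divisors of M.

module PrimeLists where

  open import Data.Nat.Base
  open import Data.Nat.Properties
  open import Data.Nat.Divisibility
  open import Data.Nat.Primality
  open import Data.Nat.Coprimality as Coprime using (Coprime; coprime-divisor; 1-coprimeTo)
  open import Data.Nat.ListAction using (product)
  open import Data.List.Base using (List; []; _∷_; filter; downFrom; length; map)
  open import Data.List.Relation.Unary.All as All using (All; []; _∷_)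
  open import Data.List.Relation.Unary.AllPairs as AllPairs using (AllPairs; []; _∷_)
  open import Data.Product.Base using (_×_; _,_; proj₁; proj₂)
  open import Data.Sum.Base using (inj₁; inj₂)
  open import Function.Base using (_∘_)
  open import Relation.Nullary using (¬_; yes; no; contradiction; _×-dec_)
  open import Relation.Unary using (Pred; Decidable)
  open import Relation.Binary.PropositionalEquality
  open import Level using (0ℓ)

  coprime-* : ∀ {a b c} → Coprime a c → Coprime b c → Coprime (a * b) c
  coprime-* a⊥c b⊥c (d∣ab , d∣c) = b⊥c (coprime-divisor (λ (i∣d , i∣a) → a⊥c (i∣a , ∣-trans i∣d d∣c)) d∣ab , d∣c)

  coprime-product : ∀ {c} qs → All (Coprime c) qs → Coprime c (product qs)
  coprime-product {c} [] [] = Coprime.sym (1-coprimeTo c)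
  coprime-product (q ∷ qs) (c⊥q ∷ c⊥qs) = Coprime.sym (coprime-* (Coprime.sym c⊥q) (Coprime.sym (coprime-product qs c⊥qs)))

  coprime-*-∣ : ∀ {a b n} → Coprime a b → a ∣ n → b ∣ n → a * b ∣ n
  coprime-*-∣ {a} {b} a⊥b a∣n (divides k refl) with coprime-divisor a⊥b (subst (a ∣_) (*-comm k b) a∣n)
  ... | a∣k = *-monoˡ-∣ b a∣k

  product-∣ : ∀ {n} qs → AllPairs Coprime qs → All (_∣ n) qs → product qs ∣ n
  product-∣ {n} [] [] [] = 1∣ n
  product-∣ (q ∷ qs) (q⊥qs ∷ qs⊥) (q∣n ∷ qs∣n) = coprime-*-∣ (coprime-product qs q⊥qs) q∣n (product-∣ qs qs⊥ qs∣n)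

  prime-∣⇒≡ : ∀ {q r} → Prime q → Prime r → q ∣ r → q ≡ r
  prime-∣⇒≡ q-prime r-prime q∣r with prime⇒irreducible r-prime q∣r
  ... | inj₁ refl = contradiction q-prime ¬prime[1]
  ... | inj₂ q≡r  = q≡r

  primes-coprime : ∀ {q r} → Prime q → Prime r → q ≢ r → Coprime q r
  primes-coprime q-prime r-prime q≢r (d∣q , d∣r) with prime⇒irreducible q-prime d∣q
  ... | inj₁ d≡1  = d≡1
  ... | inj₂ refl = contradiction (prime-∣⇒≡ q-prime r-prime d∣r) q≢r

  prime⇒2≤ : ∀ {q} → Prime q → 2 ≤ q
  prime⇒2≤ {q} q-prime = nonTrivial⇒n>1 q {{prime⇒nonTrivial q-prime}}

  module Divisors (M : ℕ) (M≢0 : M ≢ 0) where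

    open import Data.List.Relation.Unary.All.Properties as All using (all-filter; applyDownFrom⁺₁)
    import Data.List.Relation.Unary.AllPairs.Properties as AllPairs
    open import Data.List.Properties using (filter-reject)
    open import Data.List.Membership.Propositional.Properties using (∈-filter⁺; ∈-filter⁻; ∈-downFrom⁺; ∈-downFrom⁻)

    PrimeDivisor : ℕ → Set
    PrimeDivisor q = Prime q × q ∣ M

    opaque

      PrimeDivisor? : Decidable PrimeDivisor
      PrimeDivisor? q = prime? q ×-dec (q ∣? M)

      LargeDivisor? : ∀ y → Decidable (λ q → y ≤ q × PrimeDivisor q)
      LargeDivisor? y q = (y ≤? q) ×-dec PrimeDivisor? q

    -- The range of `rest` ends at `suc M + y`, although no divisor exceeds M, to have the shape
    -- `k + y` on which the inductions starting from y run.
    core rest : ℕ → List ℕ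
    core y = filter PrimeDivisor? (downFrom y)
    rest y = filter (LargeDivisor? y) (downFrom (suc M + y))

    core-prime : ∀ y → All PrimeDivisor (core y)
    core-prime y = all-filter PrimeDivisor? (downFrom y)

    rest-prime : ∀ y → All (λ q → y ≤ q × PrimeDivisor q) (rest y)
    rest-prime y = all-filter (LargeDivisor? y) (downFrom (suc M + y))

    covered : ∀ y {P : ℕ → Set} → All P (core y) → All P (rest y) → ∀ {q} → Prime q → q ∣ M → P q
    covered y core-P rest-P {q} q-prime q∣M with y ≤? q
    ... | yes y≤q = All.lookup rest-P (∈-filter⁺ (LargeDivisor? y) (∈-downFrom⁺ (≤-trans (s≤s (∣⇒≤ {{≢-nonZero M≢0}} q∣M)) (m≤m+n (suc M) y))) (y≤q , q-prime , q∣M))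
    ... | no  y≰q = All.lookup core-P (∈-filter⁺ PrimeDivisor? (∈-downFrom⁺ (≰⇒> y≰q)) (q-prime , q∣M))

    distinct : ∀ {P : Pred ℕ 0ℓ} (P? : Decidable P) n → AllPairs _≢_ (filter P? (downFrom n))
    distinct P? n = AllPairs.filter⁺ P? (AllPairs.applyDownFrom⁺₁ (λ x → x) n (λ j<i _ → ≢-sym (<⇒≢ j<i)))

    distinct⇒coprime : ∀ qs → AllPairs _≢_ qs → All PrimeDivisor qs → AllPairs Coprime qs
    distinct⇒coprime [] [] [] = []
    distinct⇒coprime (q ∷ qs) (q≢qs ∷ qs≢) ((q-prime , _) ∷ primes) =
      All.zipWith (λ (q≢r , (r-prime , _)) {d} → primes-coprime q-prime r-prime q≢r {d}) (q≢qs , primes) ∷ distinct⇒coprime qs qs≢ primes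

    core-coprime : ∀ y → AllPairs Coprime (core y)
    core-coprime y = distinct⇒coprime (core y) (distinct PrimeDivisor? y) (core-prime y)

    core-∣ : ∀ y → product (core y) ∣ M
    core-∣ y = product-∣ (core y) (core-coprime y) (All.map proj₂ (core-prime y))

    rest-coprime : ∀ y {q} → y ≤ q × PrimeDivisor q → All (Coprime q) (core y)
    rest-coprime y {q} (y≤q , q-prime , _) = All.tabulate λ {r} r∈core {d} →
      primes-coprime q-prime (proj₁ (All.lookup (core-prime y) r∈core))
        (λ { refl → <⇒≱ (∈-downFrom⁻ (proj₁ (∈-filter⁻ PrimeDivisor? {xs = downFrom y} r∈core))) y≤q }) {d}

    rest-*-core : ∀ y {q} → y ≤ q × PrimeDivisor q → q * product (core y) ∣ M
    rest-*-core y large@(_ , _ , q∣M) = coprime-*-∣ (coprime-product (core y) (rest-coprime y large)) q∣M (core-∣ y)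

    core-rest-∣ : ∀ y → product (rest y) * product (core y) ∣ M
    core-rest-∣ y = coprime-*-∣
      (Coprime.sym (coprime-product (rest y) (All.map (λ large {d} → Coprime.sym (coprime-product (core y) (rest-coprime y large)) {d}) (rest-prime y))))
      (product-∣ (rest y) (distinct⇒coprime (rest y) (distinct (LargeDivisor? y) _) (All.map proj₂ (rest-prime y))) (All.map (proj₂ ∘ proj₂) (rest-prime y)))
      (core-∣ y)

    core-rest-≤ : ∀ y → product (rest y) * product (core y) ≤ M
    core-rest-≤ y = ∣⇒≤ {{≢-nonZero M≢0}} (core-rest-∣ y)

    core-split : ∀ y k → length (core (k + y)) ≡ length (filter (LargeDivisor? y) (downFrom (k + y))) + length (core y)
    core-split y zero = cong (_+ length (core y)) (sym (none y ≤-refl))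
      where
      none : ∀ n → n ≤ y → length (filter (LargeDivisor? y) (downFrom n)) ≡ 0
      none zero    _   = refl
      none (suc n) n<y with LargeDivisor? y n
      ... | yes (y≤n , _) = contradiction y≤n (<⇒≱ n<y)
      ... | no  _         = none n (<⇒≤ n<y)
    core-split y (suc k) with LargeDivisor? y (k + y) | PrimeDivisor? (k + y)
    ... | yes _        | yes _  = cong suc (core-split y k)
    ... | no  _        | no  _  = core-split y k
    ... | yes (_ , pd) | no ¬pd = contradiction pd ¬pd
    ... | no ¬large    | yes pd = contradiction (m≤n+m y k , pd) ¬large

    core-stable : ∀ k → length (core (k + suc M)) ≡ length (core (suc M))
    core-stable zero    = refl
    core-stable (suc k) with PrimeDivisor? (k + suc M)
    ... | no  _         = core-stable k
    ... | yes (_ , x∣M) = contradiction (∣⇒≤ {{≢-nonZero M≢0}} x∣M) (<⇒≱ (m≤n+m (suc M) k))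

    -- The right side does not depend on y, so a lower bound for the number of prime divisors
    -- carries over from one cut y to another.
    rest+core : ∀ y → length (rest y) + length (core y) ≡ length (core (suc M))
    rest+core y = trans (sym (core-split y (suc M))) (trans (cong (length ∘ core) (+-comm (suc M) y)) (core-stable y))

    small-nonprime : ∀ {n d} → 2 ≤ d → d ∣ n → n ≢ d → ¬ PrimeDivisor n
    small-nonprime {n} {d} 2≤d d∣n n≢d (n-prime , _) with prime⇒irreducible n-prime d∣n
    ... | inj₁ refl = <⇒≱ 2≤d ≤-refl
    ... | inj₂ d≡n  = n≢d (sym d≡n)

    core-reject : ∀ n → ¬ PrimeDivisor n → length (core (suc n)) ≤ length (core n)
    core-reject n ¬pd with PrimeDivisor? n
    ... | yes pd = contradiction pd ¬pd
    ... | no  _  = ≤-refl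

    core-suc-≤ : ∀ n → length (core (suc n)) ≤ suc (length (core n))
    core-suc-≤ n with PrimeDivisor? n
    ... | yes _ = ≤-refl
    ... | no  _ = n≤1+n _

    -- From 6 on, primes lie in the classes 1 and 5 modulo 6, two in each block of six; the block
    -- below 6 holds 2, 3 and 5.
    core-≤ : ∀ j → length (core (suc j * 6)) ≤ j * 2 + 3
    core-≤ zero = ≤-trans (core-suc-≤ 5) (s≤s (≤-trans (core-reject 4 (small-nonprime {4} {2} ≤-refl (divides 2 refl) λ ()))
      (≤-trans (core-suc-≤ 3) (s≤s (≤-trans (core-suc-≤ 2) (s≤s (≤-trans (core-reject 1 (¬prime[1] ∘ proj₁)) (core-reject 0 (¬prime[0] ∘ proj₁)))))))))
    core-≤ (suc j) =
      ≤-trans (core-suc-≤ (5 + n)) (s≤s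
      (≤-trans (core-reject (4 + n) (small-nonprime {d = 2} ≤-refl (∣m∣n⇒∣m+n (divides 2 refl) 2∣n) λ ()))
      (≤-trans (core-reject (3 + n) (small-nonprime {d = 3} (s≤s (s≤s z≤n)) (∣m∣n⇒∣m+n (divides 1 refl) 3∣n) λ ()))
      (≤-trans (core-reject (2 + n) (small-nonprime {d = 2} ≤-refl (∣m∣n⇒∣m+n (divides 1 refl) 2∣n) λ ()))
      (≤-trans (core-suc-≤ (1 + n)) (s≤s
      (≤-trans (core-reject n (small-nonprime {d = 2} ≤-refl 2∣n λ ()))
      (core-≤ j))))))))
      where
      n : ℕ
      n = suc j * 6
      2∣n : 2 ∣ n
      2∣n = ∣n⇒∣m*n (suc j) (divides 3 refl)
      3∣n : 3 ∣ n
      3∣n = ∣n⇒∣m*n (suc j) (divides 2 refl)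

    -- The i-th prime divisor is at least i + 1, so ∏ (1 - 1/q) ≥ ∏ i/(i + 1), which telescopes to
    -- 1/(l + 1) for l prime divisors. The first component, carried through the induction, is that
    -- lower bound in the form of a count.
    core-totient : ∀ k → length (core (2 + k)) ≤ k × product (core (2 + k)) ≤ suc (length (core (2 + k))) * product (map pred (core (2 + k)))
    core-totient zero = subst (λ qs → length qs ≤ 0 × product qs ≤ suc (length qs) * product (map pred qs)) (sym core-2) (z≤n , ≤-refl)
      where
      core-2 : core 2 ≡ []
      core-2 = trans (filter-reject PrimeDivisor? (¬prime[1] ∘ proj₁)) (filter-reject PrimeDivisor? (¬prime[0] ∘ proj₁))
    core-totient (suc k) with PrimeDivisor? (2 + k) | core-totient k
    ... | no  _ | l≤k , π≤ = m≤n⇒m≤1+n l≤k , π≤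
    ... | yes _ | l≤k , π≤ = s≤s l≤k , (begin
      (2 + k) * π                    ≤⟨ *-monoʳ-≤ (2 + k) π≤ ⟩
      (2 + k) * (suc l * φ)          ≡⟨ *-assoc (2 + k) (suc l) φ ⟨
      (2 + k) * suc l * φ            ≤⟨ *-monoˡ-≤ φ ineq ⟩
      (2 + l) * (1 + k) * φ          ≡⟨ *-assoc (2 + l) (1 + k) φ ⟩
      (2 + l) * ((1 + k) * φ)        ∎)
      where
      open ≤-Reasoning
      open import Data.Nat.Tactic.RingSolver using (solve-∀)
      l π φ : ℕ
      l = length (core (2 + k))
      π = product (core (2 + k))
      φ = product (map pred (core (2 + k)))
      lhs : ∀ k l → (2 + k) * suc l ≡ 2 + k + l + l + k * l
      lhs = solve-∀
      rhs : ∀ k l → (2 + l) * (1 + k) ≡ 2 + k + k + l + k * l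
      rhs = solve-∀
      ineq : (2 + k) * suc l ≤ (2 + l) * (1 + k)
      ineq = subst₂ _≤_ (sym (lhs k l)) (sym (rhs k l)) (+-monoˡ-≤ (k * l) (+-monoˡ-≤ l (+-monoʳ-≤ (2 + k) l≤k)))

-- The sieve over the prime divisors of M.

module Sieve (M : ℕ) (p-prime : Prime (suc M)) where

  open import Data.Nat.Base as ℕ using (ℕ; zero; suc; pred; _^_; NonZero; s≤s; >-nonZero)
  import Data.Nat.Properties as ℕ
  import Data.Nat.Tactic.RingSolver as ℕ
  open import Data.Nat.DivMod using (_/_; m/n*n≡m)
  open import Data.Nat.Divisibility
  open import Data.Nat.Coprimality as Coprime using (Coprime; coprime⇒gcd≡1; 1-coprimeTo)
  open import Data.Nat.GCD using (GCD; gcd; gcd-GCD; gcd-comm; gcd[m,n]∣m; gcd[m,n]∣n; c*gcd[m,n]≡gcd[cm,cn])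
  open import Data.Nat.Primality.Factorisation using (factorise)
  open import Data.Nat.ListAction using (product; sum)
  open import Data.Integer.Base hiding (suc; pred; _^_; NonZero; _/_; >-nonZero)
  open import Data.Integer.Properties
  open import Data.Integer.Tactic.RingSolver using (solve-∀)
  open import Data.List.Base using (List; []; _∷_; length; map)
  open import Data.List.Relation.Unary.All as All using (All; []; _∷_)
  open import Data.List.Relation.Unary.AllPairs using (AllPairs; []; _∷_)
  open import Data.Product.Base using (∃-syntax; _×_; _,_; proj₁; proj₂)
  open import Relation.Nullary using (¬_; yes; no; contradiction)
  open import Relation.Binary.PropositionalEquality
  open PrimeLists using (coprime-*)
  open Residues M p-prime
  open Subgroups M p-prime
  open Variance M p-prime
  open Sums
  open Indicator

  primeDivisor : ∀ n → n ≢ 0 → n ≢ 1 → ∃[ q ] Prime q × q ∣ n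
  primeDivisor n n≢0 n≢1 with factorise n {{ℕ.≢-nonZero n≢0}}
  ... | record { factors = [] ; isFactorisation = n≡1 } = contradiction n≡1 n≢1
  ... | record { factors = q ∷ qs ; isFactorisation = n≡ ; factorsPrime = q-prime ∷ _ } = q , q-prime , divides (product qs) (trans n≡ (ℕ.*-comm q (product qs)))

  opaque

    -- The exponent M/D that cuts out H_D, extended to D = 0 so as to be total.
    cofactor : ℕ → ℕ
    cofactor zero        = zero
    cofactor D@(suc _)   = M / D

    *-cofactor : ∀ {D} → D ∣ M → D ℕ.* cofactor D ≡ M
    *-cofactor {zero}  0∣M = sym (0∣⇒≡0 0∣M)
    *-cofactor {suc d} D∣M = trans (ℕ.*-comm (suc d) (M / suc d)) (m/n*n≡m D∣M)

  M≢0 : M ≢ 0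
  M≢0 refl = contradiction 1<p λ { (s≤s ()) }

  divisor≢0 : ∀ {D} → D ∣ M → NonZero D
  divisor≢0 {zero}  0∣M = contradiction (0∣⇒≡0 0∣M) M≢0
  divisor≢0 {suc _} _   = _

  cofactor≢0 : ∀ {D} → D ∣ M → NonZero (cofactor D)
  cofactor≢0 {D} D∣M = divisor≢0 (divides D (sym (*-cofactor D∣M)))

  χ[_] : ℕ → ℕ → ℤ
  χ[ D ] = χ (cofactor D)

  cofactor-*ˡ : ∀ D q → D ℕ.* q ∣ M → cofactor D ≡ q ℕ.* cofactor (D ℕ.* q)
  cofactor-*ˡ D q Dq∣M = ℕ.*-cancelˡ-≡ _ _ D {{divisor≢0 D∣M}}
    (trans (*-cofactor D∣M) (trans (sym (*-cofactor Dq∣M)) (ℕ.*-assoc D q _)))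
    where
    D∣M : D ∣ M
    D∣M = m*n∣⇒m∣ D q Dq∣M

  cofactor-*ʳ : ∀ D q → D ℕ.* q ∣ M → cofactor q ≡ D ℕ.* cofactor (D ℕ.* q)
  cofactor-*ʳ D q Dq∣M = trans (cofactor-*ˡ q D (subst (_∣ M) (ℕ.*-comm D q) Dq∣M)) (cong (λ a → D ℕ.* cofactor a) (ℕ.*-comm q D))

  GCD-cofactor : ∀ {D q} → Coprime D q → D ℕ.* q ∣ M → GCD (cofactor D) (cofactor q) (cofactor (D ℕ.* q))
  GCD-cofactor {D} {q} D⊥q Dq∣M = subst (GCD (cofactor D) (cofactor q)) gcd≡ (gcd-GCD (cofactor D) (cofactor q))
    where
    open ≡-Reasoning
    r : ℕ
    r = cofactor (D ℕ.* q)
    gcd≡ : gcd (cofactor D) (cofactor q) ≡ r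
    gcd≡ = begin
      gcd (cofactor D) (cofactor q)  ≡⟨ cong₂ gcd (trans (cofactor-*ˡ D q Dq∣M) (ℕ.*-comm q r)) (trans (cofactor-*ʳ D q Dq∣M) (ℕ.*-comm D r)) ⟩
      gcd (r ℕ.* q) (r ℕ.* D)        ≡⟨ c*gcd[m,n]≡gcd[cm,cn] r q D ⟨
      r ℕ.* gcd q D                  ≡⟨ cong (r ℕ.*_) (trans (gcd-comm q D) (coprime⇒gcd≡1 D⊥q)) ⟩
      r ℕ.* 1                        ≡⟨ ℕ.*-identityʳ r ⟩
      r                              ∎

  -- This is H_D ∩ H_q = H_(Dq): an x in both satisfies x^g = 1 for the gcd g of M/D and M/q, and g
  -- is M/(Dq) because D and q are coprime.
  χ-coprime : ∀ {D q} x → Coprime D q → D ℕ.* q ∣ M → χ[ D ℕ.* q ] x ≡ χ[ D ] x * χ[ q ] x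
  χ-coprime {D} {q} x D⊥q Dq∣M = 𝟙-* (x ^ cofactor D ≈? 1) (x ^ cofactor q ≈? 1) (x ^ cofactor (D ℕ.* q) ≈? 1)
    (λ xr≈1 → subst (λ e → x ^ e ≈ 1) (sym (cofactor-*ˡ D q Dq∣M)) (≈1-* x q xr≈1))
    (λ xr≈1 → subst (λ e → x ^ e ≈ 1) (sym (cofactor-*ʳ D q Dq∣M)) (≈1-* x D xr≈1))
    (λ xD≈1 xq≈1 → ≈1-gcd x (λ x≈0 → 0^≉1 (cofactor D) {{cofactor≢0 (m*n∣⇒m∣ D q Dq∣M)}} x≈0 xD≈1) xD≈1 xq≈1 (GCD-cofactor D⊥q Dq∣M))

  -- For c D = ∑_{x ∈ H_D} w x this is the sum of w over the x ∈ H_D lying in no H_q with q ∈ qs.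
  sift : (ℕ → ℤ) → ℕ → List ℕ → ℤ
  sift c D []       = c D
  sift c D (q ∷ qs) = sift c D qs - sift c (D ℕ.* q) qs

  totient : List ℕ → ℕ
  totient qs = product (map pred qs)

  private
    module _ {D q qs} (D*qqs∣M : D ℕ.* (q ℕ.* product qs) ∣ M) where

      drop∣M : D ℕ.* product qs ∣ M
      drop∣M = ∣-trans (*-monoʳ-∣ D (n∣m*n q)) D*qqs∣M

      shift∣M : D ℕ.* q ℕ.* product qs ∣ M
      shift∣M = subst (_∣ M) (sym (ℕ.*-assoc D q (product qs))) D*qqs∣M

      head∣M : D ℕ.* q ∣ M
      head∣M = m*n∣⇒m∣ (D ℕ.* q) (product qs) shift∣M

  -- Euler's product (M/D) ∏ (1 - 1/q), multiplied out. Both branches of `sift` yield the same M φ,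
  -- the first taken q times and the second once, so q - 1 copies remain.
  sift-size : ∀ D qs → D ℕ.* product qs ∣ M → sift (λ D → + cofactor D) D qs * + (D ℕ.* product qs) ≡ + (M ℕ.* totient qs)
  sift-size D [] D∣M = trans (sym (pos-* (cofactor D) (D ℕ.* 1))) (cong +_ (begin
    cofactor D ℕ.* (D ℕ.* 1)  ≡⟨ cong (cofactor D ℕ.*_) (ℕ.*-identityʳ D) ⟩
    cofactor D ℕ.* D          ≡⟨ ℕ.*-comm (cofactor D) D ⟩
    D ℕ.* cofactor D          ≡⟨ *-cofactor (subst (_∣ M) (ℕ.*-identityʳ D) D∣M) ⟩
    M                         ≡⟨ ℕ.*-identityʳ M ⟨
    M ℕ.* 1                   ∎))
    where open ≡-Reasoning
  sift-size D (zero ∷ qs) D*qqs∣M = contradiction (0∣⇒≡0 (subst (_∣ M) (ℕ.*-zeroʳ D) D*qqs∣M)) M≢0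
  sift-size D (q@(suc q-1) ∷ qs) D*qqs∣M = begin
    (S₁ - S₂) * + (D ℕ.* (q ℕ.* π))      ≡⟨ cong (_*_ (S₁ - S₂)) cast ⟩
    (S₁ - S₂) * (+ q * + (D ℕ.* π))      ≡⟨ expand S₁ S₂ (+ q) (+ (D ℕ.* π)) ⟩
    + q * (S₁ * + (D ℕ.* π)) - S₂ * (+ q * + (D ℕ.* π))
      ≡⟨ cong₂ (λ i j → + q * i - j) (sift-size D qs (drop∣M {D} {q} {qs} D*qqs∣M))
           (trans (cong (_*_ S₂) (trans (sym cast) (cong +_ (sym (ℕ.*-assoc D q π))))) (sift-size (D ℕ.* q) qs (shift∣M {D} {q} {qs} D*qqs∣M))) ⟩
    + q * + (M ℕ.* φ) - + (M ℕ.* φ)      ≡⟨ collect (+ q-1) (+ (M ℕ.* φ)) ⟩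
    + q-1 * + (M ℕ.* φ)                  ≡⟨ pos-* q-1 (M ℕ.* φ) ⟨
    + (q-1 ℕ.* (M ℕ.* φ))                ≡⟨ cong +_ (swap q-1 M φ) ⟩
    + (M ℕ.* (q-1 ℕ.* φ))                ∎
    where
    open ≡-Reasoning
    π φ : ℕ
    π = product qs
    φ = totient qs
    S₁ S₂ : ℤ
    S₁ = sift (λ D → + cofactor D) D qs
    S₂ = sift (λ D → + cofactor D) (D ℕ.* q) qs
    swap : ∀ a b c → a ℕ.* (b ℕ.* c) ≡ b ℕ.* (a ℕ.* c)
    swap = ℕ.solve-∀
    cast : + (D ℕ.* (q ℕ.* π)) ≡ + q * + (D ℕ.* π)
    cast = trans (cong +_ (swap D q π)) (pos-* q (D ℕ.* π))
    expand : ∀ a b c d → (a - b) * (c * d) ≡ c * (a * d) - b * (c * d)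
    expand = solve-∀
    collect : ∀ q y → (1ℤ + q) * y - y ≡ q * y
    collect = solve-∀

  free : List ℕ → ℕ → ℤ
  free []       x = 1ℤ
  free (q ∷ qs) x = (1ℤ - χ[ q ] x) * free qs x

  sift-χ : ∀ D qs x → D ℕ.* product qs ∣ M → All (Coprime D) qs → AllPairs Coprime qs →
           sift (λ D → χ[ D ] x) D qs ≡ χ[ D ] x * free qs x
  sift-χ D []       x _ _ _ = sym (*-identityʳ _)
  sift-χ D (q ∷ qs) x D*qqs∣M (D⊥q ∷ D⊥qs) (q⊥qs ∷ qs⊥) = begin
    sift c D qs - sift c (D ℕ.* q) qs
      ≡⟨ cong₂ _-_ (sift-χ D qs x (drop∣M {D} {q} {qs} D*qqs∣M) D⊥qs qs⊥)
           (sift-χ (D ℕ.* q) qs x (shift∣M {D} {q} {qs} D*qqs∣M) (All.zipWith both (D⊥qs , q⊥qs)) qs⊥) ⟩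
    χ[ D ] x * free qs x - χ[ D ℕ.* q ] x * free qs x
      ≡⟨ cong (λ i → χ[ D ] x * free qs x - i * free qs x) (χ-coprime x D⊥q (head∣M {D} {q} {qs} D*qqs∣M)) ⟩
    χ[ D ] x * free qs x - χ[ D ] x * χ[ q ] x * free qs x
      ≡⟨ collect (χ[ D ] x) (χ[ q ] x) (free qs x) ⟩
    χ[ D ] x * ((1ℤ - χ[ q ] x) * free qs x) ∎
    where
    open ≡-Reasoning
    c : ℕ → ℤ
    c D = χ[ D ] x
    collect : ∀ a b f → a * f - a * b * f ≡ a * ((1ℤ - b) * f)
    collect = solve-∀
    both : ∀ {r} → Coprime D r × Coprime q r → Coprime (D ℕ.* q) r
    both {r} (D⊥r , q⊥r) = coprime-* {D} {q} {r} D⊥r q⊥r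

  sift-Φ : ∀ N D qs → Φ N (λ x → sift (λ D → χ[ D ] x) D qs) ≡ sift (λ D → Φ N χ[ D ]) D qs
  sift-Φ N D []       = refl
  sift-Φ N D (q ∷ qs) = trans (Φ-minus N (λ x → sift (λ D → χ[ D ] x) D qs) (λ x → sift (λ D → χ[ D ] x) (D ℕ.* q) qs)) (cong₂ _-_ (sift-Φ N D qs) (sift-Φ N (D ℕ.* q) qs))

  -- `sift` is a signed sum with one term for each subset of `qs`, hence 2^length errors of size at
  -- most B. The functions `a` and `s` become the counts in the box and the sizes of the subgroups.
  sift-error : ∀ (a s : ℕ → ℤ) m n B → (∀ {D} → D ∣ M → ∣ m * a D - s D * n ∣ ℕ.≤ B) →
               ∀ D qs → D ℕ.* product qs ∣ M → ∣ m * sift a D qs - sift s D qs * n ∣ ℕ.≤ 2 ^ length qs ℕ.* B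
  sift-error a s m n B error D [] D∣M = subst (∣ m * a D - s D * n ∣ ℕ.≤_) (sym (ℕ.+-identityʳ B)) (error (subst (_∣ M) (ℕ.*-identityʳ D) D∣M))
  sift-error a s m n B error D (q ∷ qs) D*qqs∣M = begin
    ∣ m * (a₁ - a₂) - (s₁ - s₂) * n ∣               ≡⟨ cong ∣_∣ (split m n a₁ a₂ s₁ s₂) ⟩
    ∣ (m * a₁ - s₁ * n) - (m * a₂ - s₂ * n) ∣       ≤⟨ ∣i-j∣≤∣i∣+∣j∣ (m * a₁ - s₁ * n) _ ⟩
    ∣ m * a₁ - s₁ * n ∣ ℕ.+ ∣ m * a₂ - s₂ * n ∣     ≤⟨ ℕ.+-mono-≤ (sift-error a s m n B error D qs (drop∣M {D} {q} {qs} D*qqs∣M))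
                                                                     (sift-error a s m n B error (D ℕ.* q) qs (shift∣M {D} {q} {qs} D*qqs∣M)) ⟩
    2 ^ length qs ℕ.* B ℕ.+ 2 ^ length qs ℕ.* B     ≡⟨ double (2 ^ length qs) B ⟩
    2 ^ length (q ∷ qs) ℕ.* B                       ∎
    where
    open ℕ.≤-Reasoning
    a₁ a₂ s₁ s₂ : ℤ
    a₁ = sift a D qs
    a₂ = sift a (D ℕ.* q) qs
    s₁ = sift s D qs
    s₂ = sift s (D ℕ.* q) qs
    split : ∀ m n a b s t → m * (a - b) - (s - t) * n ≡ (m * a - s * n) - (m * b - t * n)
    split = solve-∀
    double : ∀ x B → x ℕ.* B ℕ.+ x ℕ.* B ≡ 2 ℕ.* x ℕ.* B
    double = ℕ.solve-∀

  module Weighted (core : List ℕ) (core∣M : product core ∣ M) (core⊥ : AllPairs Coprime core) where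

    Outside : ℕ → Set
    Outside q = q ℕ.* product core ∣ M × All (Coprime q) core

    -- Union bound: from what survives the core, the part inside H_q is subtracted for each q of the
    -- rest. What lies in several H_q is subtracted several times.
    weight : (ℕ → ℤ) → List ℕ → ℤ
    weight c []       = sift c 1 core
    weight c (q ∷ qs) = weight c qs - sift c q core

    1*core∣M : 1 ℕ.* product core ∣ M
    1*core∣M = subst (_∣ M) (sym (ℕ.*-identityˡ (product core))) core∣M

    weight-Φ : ∀ N qs → Φ N (λ x → weight (λ D → χ[ D ] x) qs) ≡ weight (λ D → Φ N χ[ D ]) qs
    weight-Φ N []       = sift-Φ N 1 core
    weight-Φ N (q ∷ qs) = trans (Φ-minus N (λ x → weight (λ D → χ[ D ] x) qs) (λ x → sift (λ D → χ[ D ] x) q core)) (cong₂ _-_ (weight-Φ N qs) (sift-Φ N q core))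

    weight-error : ∀ (a s : ℕ → ℤ) m n B → (∀ {D} → D ∣ M → ∣ m * a D - s D * n ∣ ℕ.≤ B) →
                   ∀ qs → All Outside qs → ∣ m * weight a qs - weight s qs * n ∣ ℕ.≤ suc (length qs) ℕ.* (2 ^ length core ℕ.* B)
    weight-error a s m n B error [] [] = subst (∣ m * weight a [] - weight s [] * n ∣ ℕ.≤_) (sym (ℕ.*-identityˡ _)) (sift-error a s m n B error 1 core 1*core∣M)
    weight-error a s m n B error (q ∷ qs) ((q*core∣M , _) ∷ outside) = begin
      ∣ m * (a₁ - a₂) - (s₁ - s₂) * n ∣               ≡⟨ trans (cong ∣_∣ (split m n a₁ a₂ s₁ s₂)) (∣-i∣≡∣i∣ (m * a₂ - s₂ * n - (m * a₁ - s₁ * n))) ⟩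
      ∣ (m * a₂ - s₂ * n) - (m * a₁ - s₁ * n) ∣       ≤⟨ ∣i-j∣≤∣i∣+∣j∣ (m * a₂ - s₂ * n) (m * a₁ - s₁ * n) ⟩
      ∣ m * a₂ - s₂ * n ∣ ℕ.+ ∣ m * a₁ - s₁ * n ∣     ≤⟨ ℕ.+-mono-≤ (sift-error a s m n B error q core q*core∣M) (weight-error a s m n B error qs outside) ⟩
      suc (length (q ∷ qs)) ℕ.* (2 ^ length core ℕ.* B) ∎
      where
      open ℕ.≤-Reasoning
      a₁ a₂ s₁ s₂ : ℤ
      a₁ = weight a qs
      a₂ = sift a q core
      s₁ = weight s qs
      s₂ = sift s q core
      split : ∀ m n a b s t → m * (a - b) - (s - t) * n ≡ - ((m * b - t * n) - (m * a - s * n))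
      split = solve-∀

    margin : ℕ → List ℕ → ℤ
    margin x []       = χ[ 1 ] x
    margin x (q ∷ qs) = margin x qs - χ[ q ] x

    -- For a unit x the margin is 1 minus the number of q in `qs` with x ∈ H_q. The product is
    -- therefore positive only at an x that avoids every H_q, for the core and the rest alike.
    weight-χ : ∀ x qs → All Outside qs → weight (λ D → χ[ D ] x) qs ≡ margin x qs * free core x
    weight-χ x [] [] = sift-χ 1 core x 1*core∣M (All.universal (λ q {d} → 1-coprimeTo q {d}) core) core⊥
    weight-χ x (q ∷ qs) ((q*core∣M , q⊥core) ∷ outside) =
      trans (cong₂ _-_ (weight-χ x qs outside) (sift-χ q core x q*core∣M q⊥core core⊥)) (collect (margin x qs) (χ[ q ] x) (free core x))
      where
      collect : ∀ a b f → a * f - b * f ≡ (a - b) * f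
      collect = solve-∀

    margin≤1 : ∀ x qs → margin x qs ≤ 1ℤ
    margin≤1 x []       = 𝟙≤1 (x ^ cofactor 1 ≈? 1)
    margin≤1 x (q ∷ qs) = ≤-trans (+-mono-≤ (margin≤1 x qs) (neg-mono-≤ (0≤𝟙 (x ^ cofactor q ≈? 1)))) (≤-reflexive (+-identityʳ 1ℤ))

    Avoids : ℕ → ℕ → Set
    Avoids x q = ¬ x ^ cofactor q ≈ 1

    -- The margin is at most 1, so a single q with x ∈ H_q already brings it down to 0 or less.
    margin>0 : ∀ x qs → 0ℤ < margin x qs → x ^ cofactor 1 ≈ 1 × All (Avoids x) qs
    margin>0 x [] 0<χ with x ^ cofactor 1 ≈? 1
    ... | yes xM≈1 = xM≈1 , []
    ... | no  _    = contradiction 0<χ (<-irrefl refl)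
    margin>0 x (q ∷ qs) 0<m with x ^ cofactor q ≈? 1
    ... | yes _   = contradiction (≤-trans (+-monoˡ-≤ (- 1ℤ) (margin≤1 x qs)) (≤-reflexive (+-inverseʳ 1ℤ))) (<⇒≱ 0<m)
    ... | no  x∉H with margin>0 x qs (subst (0ℤ <_) (+-identityʳ (margin x qs)) 0<m)
    ...   | xM≈1 , avoids = xM≈1 , x∉H ∷ avoids

    free>0 : ∀ x i qs → 0ℤ < i * free qs x → 0ℤ < i × All (Avoids x) qs
    free>0 x i [] 0<i*1 = subst (0ℤ <_) (*-identityʳ i) 0<i*1 , []
    free>0 x i (q ∷ qs) 0<if with x ^ cofactor q ≈? 1
    ... | yes _   = contradiction 0<if (<-irrefl (sym (trans (cong (_*_ i) (*-zeroˡ (free qs x))) (*-zeroʳ i))))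
    ... | no  x∉H with free>0 x i qs (subst (λ f → 0ℤ < i * f) (*-identityˡ (free qs x)) 0<if)
    ...   | 0<i , avoids = 0<i , x∉H ∷ avoids

  -- If x^k = 1 with 0 < k < M, then x^d = 1 for d = gcd k M, a proper divisor of M. A prime q
  -- dividing M/d makes M/q a multiple of d, so x^(M/q) = 1, against the hypothesis on q.
  avoids⇒primitive : ∀ x → x ^ cofactor 1 ≈ 1 → (∀ {q} → Prime q → q ∣ M → ¬ x ^ cofactor q ≈ 1) → IsPrimitiveRoot p x
  avoids⇒primitive x xM≈1 avoids = %≡ (fermat x x≉0) , λ k 1≤k k<M xk≡1 → minimal k 1≤k k<M (mk≈ xk≡1)
    where
    x≉0 : ¬ x ≈ 0
    x≉0 x≈0 = 0^≉1 (cofactor 1) {{cofactor≢0 (1∣ M)}} x≈0 xM≈1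
    minimal : ∀ k → 1 ℕ.≤ k → k ℕ.< M → ¬ x ^ k ≈ 1
    minimal k 1≤k k<M xk≈1 with gcd[m,n]∣n k M
    ... | divides t M≡td with primeDivisor t t≢0 t≢1
      where
      d : ℕ
      d = gcd k M
      t≢0 : t ≢ 0
      t≢0 refl = M≢0 M≡td
      t≢1 : t ≢ 1
      t≢1 refl = ℕ.<⇒≱ k<M (subst (ℕ._≤ k) (sym (trans M≡td (ℕ.*-identityˡ d))) (∣⇒≤ {{>-nonZero 1≤k}} (gcd[m,n]∣m k M)))
    ...   | q , q-prime , divides s t≡sq = avoids q-prime q∣M (subst (λ e → x ^ e ≈ 1) (sym cofactor≡) (≈1-* x s xd≈1))
      where
      d : ℕ
      d = gcd k M
      xd≈1 : x ^ d ≈ 1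
      xd≈1 = ≈1-gcd x x≉0 xk≈1 (fermat x x≉0) (gcd-GCD k M)
      regroup : ∀ s q d → s ℕ.* q ℕ.* d ≡ q ℕ.* (s ℕ.* d)
      regroup = ℕ.solve-∀
      M≡ : M ≡ q ℕ.* (s ℕ.* d)
      M≡ = trans M≡td (trans (cong (ℕ._* d) t≡sq) (regroup s q d))
      q∣M : q ∣ M
      q∣M = subst (q ∣_) (sym M≡) (m∣m*n (s ℕ.* d))
      cofactor≡ : cofactor q ≡ s ℕ.* d
      cofactor≡ = ℕ.*-cancelˡ-≡ _ _ q {{divisor≢0 q∣M}} (trans (*-cofactor q∣M) M≡)

  size : ℕ → ℤ
  size D = + cofactor D

  -- `sift size` is a signed sum; its sign is read off from the product formula, where a positive
  -- multiple of it is a natural number.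
  nonNeg-quotient : ∀ i n k → .{{NonZero n}} → i * + n ≡ + k → i ≡ + ∣ i ∣
  nonNeg-quotient (+ _)    n       k _  = refl
  nonNeg-quotient -[1+ _ ] (suc _) k ()

  sift-sizeℕ : ∀ D qs → D ℕ.* product qs ∣ M →
               ∃[ K ] sift size D qs ≡ + K × K ℕ.* (D ℕ.* product qs) ≡ M ℕ.* totient qs
  sift-sizeℕ D qs Dqs∣M = ∣ κ ∣ , κ≡ , +-injective (trans (pos-* ∣ κ ∣ _) (trans (cong (_* + (D ℕ.* product qs)) (sym κ≡)) (sift-size D qs Dqs∣M)))
    where
    κ : ℤ
    κ = sift size D qs
    κ≡ : κ ≡ + ∣ κ ∣
    κ≡ = nonNeg-quotient κ (D ℕ.* product qs) _ {{divisor≢0 Dqs∣M}} (sift-size D qs Dqs∣M)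

  module Count (core : List ℕ) (core∣M : product core ∣ M) (core⊥ : AllPairs Coprime core) where

    open Weighted core core∣M core⊥

    -- The number of units surviving the core, M ∏ (1 - 1/q). For a prime q of the rest, K/q of them
    -- lie in H_q.
    K : ℕ
    K = proj₁ (sift-sizeℕ 1 core 1*core∣M)

    κ≡K : sift size 1 core ≡ + K
    κ≡K = proj₁ (proj₂ (sift-sizeℕ 1 core 1*core∣M))

    K*core : K ℕ.* product core ≡ M ℕ.* totient core
    K*core = trans (cong (K ℕ.*_) (sym (ℕ.*-identityˡ (product core)))) (proj₂ (proj₂ (sift-sizeℕ 1 core 1*core∣M)))

    outside-size : ∀ {q} → Outside q → ∃[ k ] sift size q core ≡ + k × k ℕ.* q ≡ K
    outside-size {q} (q*core∣M , _) with sift-sizeℕ q core q*core∣M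
    ... | k , κ≡k , k*q*core = k , κ≡k , ℕ.*-cancelʳ-≡ _ _ (product core) {{divisor≢0 core∣M}}
      (trans (ℕ.*-assoc k q (product core)) (trans k*q*core (sym K*core)))

    -- The fraction w(q)/b bounds 1/q from above, and each q removes K/q. Divided by b K, the claim
    -- is W/K ≥ 1 - ∑ w(q)/b for the weight W of the sizes.
    weight-size : ∀ (w : ℕ → ℕ) b qs → All Outside qs → All (λ q → b ℕ.≤ w q ℕ.* q) qs →
                  + (b ℕ.* K) ≤ + b * weight size qs + + (sum (map w qs) ℕ.* K)
    weight-size w b [] [] [] = ≤-reflexive (trans (pos-* b K) (trans (cong (_*_ (+ b)) (sym κ≡K)) (sym (+-identityʳ _))))
    weight-size w b (q ∷ qs) (out ∷ outside) (b≤wq ∷ b≤w) with outside-size out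
    ... | k , κ≡k , kq≡K = begin
      + (b ℕ.* K)                                              ≤⟨ weight-size w b qs outside b≤w ⟩
      + b * W + + (S ℕ.* K)                                    ≡⟨ split (+ b) W (+ k) (+ (S ℕ.* K)) ⟩
      + b * (W - + k) + (+ b * + k + + (S ℕ.* K))              ≤⟨ +-monoʳ-≤ (+ b * (W - + k)) (+-monoˡ-≤ (+ (S ℕ.* K)) bk≤wK) ⟩
      + b * (W - + k) + + (w q ℕ.* K ℕ.+ S ℕ.* K)              ≡⟨ cong₂ (λ i j → + b * (W - i) + + j) (sym κ≡k) (sym (ℕ.*-distribʳ-+ K (w q) S)) ⟩
      + b * (W - sift size q core) + + ((w q ℕ.+ S) ℕ.* K)     ∎
      where
      open ≤-Reasoning
      W : ℤ
      W = weight size qs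
      S : ℕ
      S = sum (map w qs)
      split : ∀ b W k s → b * W + s ≡ b * (W - k) + (b * k + s)
      split = solve-∀
      regroup : ∀ w q k → w ℕ.* q ℕ.* k ≡ w ℕ.* (k ℕ.* q)
      regroup = ℕ.solve-∀
      bk≤wK : + b * + k ≤ + (w q ℕ.* K)
      bk≤wK = subst (_≤ + (w q ℕ.* K)) (pos-* b k) (+≤+ (ℕ.≤-trans (ℕ.*-monoˡ-≤ k b≤wq) (ℕ.≤-reflexive (trans (regroup (w q) q k) (cong (w q ℕ.*_) kq≡K)))))

    βK≥αM : ∀ α β → α ℕ.* product core ℕ.≤ β ℕ.* totient core → α ℕ.* M ℕ.≤ β ℕ.* K
    βK≥αM α β αΠ≤βφ = ℕ.*-cancelʳ-≤ _ _ (product core) {{divisor≢0 core∣M}} (begin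
      α ℕ.* M ℕ.* product core        ≡⟨ swap α M (product core) ⟩
      α ℕ.* product core ℕ.* M        ≤⟨ ℕ.*-monoˡ-≤ M αΠ≤βφ ⟩
      β ℕ.* totient core ℕ.* M        ≡⟨ trans (ℕ.*-assoc β _ M) (cong (β ℕ.*_) (trans (ℕ.*-comm (totient core) M) (sym K*core))) ⟩
      β ℕ.* (K ℕ.* product core)      ≡⟨ ℕ.*-assoc β K (product core) ⟨
      β ℕ.* K ℕ.* product core        ∎)
      where
      open ℕ.≤-Reasoning
      swap : ∀ a b c → a ℕ.* b ℕ.* c ≡ a ℕ.* c ℕ.* b
      swap = ℕ.solve-∀

    -- Cleared fractions: c/b bounds ∑ 1/q over the rest from above, hence δ/b bounds 1 - ∑ 1/q from
    -- below, and α/β bounds ∏ (1 - 1/q) over the core from below. In these terms `large` says N/P >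
    -- (s + 1) 2^m / ((δ/b)(α/β)).
    module _ (rest : List ℕ) (outside : All Outside rest) (N P : ℕ) (2N≤p : N ℕ.+ N ℕ.≤ p) (p≤P² : p ℕ.≤ P ℕ.* P)
             (w : ℕ → ℕ) (b c δ α β : ℕ)
             (b≤w : All (λ q → b ℕ.≤ w q ℕ.* q) rest) (∑w≤c : sum (map w rest) ℕ.≤ c) (δ+c≤b : δ ℕ.+ c ℕ.≤ b)
             (αΠ≤βφ : α ℕ.* product core ℕ.≤ β ℕ.* totient core)
             (large : b ℕ.* β ℕ.* (suc (length rest) ℕ.* 2 ^ length core ℕ.* P) ℕ.< N ℕ.* (δ ℕ.* α)) where

      W A n² : ℤ
      W = weight size rest
      A = weight (λ D → Φ N χ[ D ]) rest
      n² = + N * + N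

      E : ℕ
      E = suc (length rest) ℕ.* (2 ^ length core ℕ.* (N ℕ.* P ℕ.* M))

      error : ∣ + M * A - W * n² ∣ ℕ.≤ E
      error = weight-error (λ D → Φ N χ[ D ]) size (+ M) n² (N ℕ.* P ℕ.* M)
        (λ {D} D∣M → Discrepancy.discrepancy D (cofactor D) {{cofactor≢0 D∣M}} (*-cofactor D∣M) N P 2N≤p p≤P²) rest outside

      δK≤bW : + (δ ℕ.* K) ≤ + b * W
      δK≤bW = +-cancelʳ-≤ (+ (c ℕ.* K)) (begin
        + (δ ℕ.* K ℕ.+ c ℕ.* K)                    ≤⟨ +≤+ (subst (ℕ._≤ b ℕ.* K) (ℕ.*-distribʳ-+ K δ c) (ℕ.*-monoˡ-≤ K δ+c≤b)) ⟩
        + (b ℕ.* K)                                ≤⟨ weight-size w b rest outside b≤w ⟩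
        + b * W + + (sum (map w rest) ℕ.* K)       ≤⟨ +-monoʳ-≤ (+ b * W) (+≤+ (ℕ.*-monoˡ-≤ K ∑w≤c)) ⟩
        + b * W + + (c ℕ.* K)                      ∎)
        where
        open ≤-Reasoning
        +-cancelʳ-≤ : ∀ k {i j} → i + k ≤ j + k → i ≤ j
        +-cancelʳ-≤ k {i} {j} i+k≤j+k = subst₂ _≤_ (cancel i k) (cancel j k) (+-monoˡ-≤ (- k) i+k≤j+k)
          where
          cancel : ∀ i k → i + k - k ≡ i
          cancel = solve-∀

      N>0 : 0 ℕ.< N
      N>0 = ℕ.n≢0⇒n>0 λ { refl → ℕ.n≮0 large }

      E<Wn² : + E < W * n²
      E<Wn² = *-cancelˡ-<-nonNeg (+ (b ℕ.* β)) (begin-strict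
        + (b ℕ.* β) * + E                        ≡⟨ pos-* (b ℕ.* β) E ⟨
        + (b ℕ.* β ℕ.* E)                        ≡⟨ cong +_ (regroup (b ℕ.* β) (suc (length rest)) (2 ^ length core) N P M) ⟩
        + (N ℕ.* M ℕ.* (b ℕ.* β ℕ.* (suc (length rest) ℕ.* 2 ^ length core ℕ.* P)))
                                                 <⟨ +<+ (ℕ.*-monoʳ-< (N ℕ.* M) {{NM≢0}} large) ⟩
        + (N ℕ.* M ℕ.* (N ℕ.* (δ ℕ.* α)))        ≡⟨ cong +_ (regroup₂ N M δ α) ⟩
        + (N ℕ.* N ℕ.* δ ℕ.* (α ℕ.* M))          ≤⟨ +≤+ (ℕ.*-monoʳ-≤ (N ℕ.* N ℕ.* δ) (βK≥αM α β αΠ≤βφ)) ⟩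
        + (N ℕ.* N ℕ.* δ ℕ.* (β ℕ.* K))          ≡⟨ cong +_ (regroup₃ N δ β K) ⟩
        + (N ℕ.* N ℕ.* β ℕ.* (δ ℕ.* K))          ≡⟨ pos-* (N ℕ.* N ℕ.* β) (δ ℕ.* K) ⟩
        + (N ℕ.* N ℕ.* β) * + (δ ℕ.* K)          ≤⟨ *-monoˡ-≤-nonNeg (+ (N ℕ.* N ℕ.* β)) δK≤bW ⟩
        + (N ℕ.* N ℕ.* β) * (+ b * W)            ≡⟨ cong (_* (+ b * W)) (trans (pos-* (N ℕ.* N) β) (cong (_* + β) (pos-* N N))) ⟩
        n² * + β * (+ b * W)                     ≡⟨ regroup₄ n² (+ β) (+ b) W ⟩
        + b * + β * (W * n²)                     ≡⟨ cong (_* (W * n²)) (pos-* b β) ⟨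
        + (b ℕ.* β) * (W * n²)                   ∎)
        where
        open ≤-Reasoning
        NM≢0 : NonZero (N ℕ.* M)
        NM≢0 = ℕ.m*n≢0 N M {{>-nonZero N>0}} {{ℕ.≢-nonZero M≢0}}
        regroup : ∀ a s t N P M → a ℕ.* (s ℕ.* (t ℕ.* (N ℕ.* P ℕ.* M))) ≡ N ℕ.* M ℕ.* (a ℕ.* (s ℕ.* t ℕ.* P))
        regroup = ℕ.solve-∀
        regroup₂ : ∀ N M δ α → N ℕ.* M ℕ.* (N ℕ.* (δ ℕ.* α)) ≡ N ℕ.* N ℕ.* δ ℕ.* (α ℕ.* M)
        regroup₂ = ℕ.solve-∀
        regroup₃ : ∀ N δ β K → N ℕ.* N ℕ.* δ ℕ.* (β ℕ.* K) ≡ N ℕ.* N ℕ.* β ℕ.* (δ ℕ.* K)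
        regroup₃ = ℕ.solve-∀
        regroup₄ : ∀ n β b W → n * β * (b * W) ≡ b * β * (W * n)
        regroup₄ = solve-∀

      -- If M A were at most 0, then W n² would be at most |M A - W n²| ≤ E, against E < W n².
      A>0 : 0ℤ < A
      A>0 = *-cancelˡ-<-nonNeg (+ M) (subst (_< + M * A) (sym (*-zeroʳ (+ M))) (≰⇒> λ MA≤0 → <-irrefl refl (begin-strict
        + E                        <⟨ E<Wn² ⟩
        W * n²                     ≡⟨ +-identityʳ (W * n²) ⟨
        W * n² + - 0ℤ              ≤⟨ +-monoʳ-≤ (W * n²) (neg-mono-≤ MA≤0) ⟩
        W * n² - + M * A           ≤⟨ i≤∣i∣ (W * n² - + M * A) ⟩
        + ∣ W * n² - + M * A ∣     ≡⟨ cong +_ (∣i-j∣≡∣j-i∣ (W * n²) (+ M * A)) ⟩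
        + ∣ + M * A - W * n² ∣     ≤⟨ +≤+ error ⟩
        + E                        ∎)))
        where
        open ≤-Reasoning
        i≤∣i∣ : ∀ i → i ≤ + ∣ i ∣
        i≤∣i∣ (+ _)    = ≤-refl
        i≤∣i∣ -[1+ _ ] = -≤+

      f : ℕ → ℤ
      f x = weight (λ D → χ[ D ] x) rest

      Sifted : ℕ → Set
      Sifted x = x ^ cofactor 1 ≈ 1 × All (Avoids x) core × All (Avoids x) rest

      f>0⇒sifted : ∀ x → 0ℤ < f x → Sifted x
      f>0⇒sifted x 0<f = proj₁ on-rest , proj₂ on-core , proj₂ on-rest
        where
        on-core : 0ℤ < margin x rest × All (Avoids x) core
        on-core = free>0 x (margin x rest) core (subst (0ℤ <_) (weight-χ x rest outside) 0<f)
        on-rest : x ^ cofactor 1 ≈ 1 × All (Avoids x) rest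
        on-rest = margin>0 x rest (proj₁ on-core)

      Φf>0 : 0ℤ < Φ N f
      Φf>0 = subst (0ℤ <_) (sym (weight-Φ N rest)) A>0

      sifted : ∃[ x ] 1 ℕ.≤ x × x ℕ.< N ℕ.+ N × Sifted x
      sifted = locate (∑-positive N {row} Φf>0)
        where
        row : ℕ → ℤ
        row u = ∑ N (λ v → f (u ℕ.+ 1 ℕ.+ v))
        locate : ∃[ u ] u ℕ.< N × 0ℤ < row u → ∃[ x ] 1 ℕ.≤ x × x ℕ.< N ℕ.+ N × Sifted x
        locate (u , u<N , 0<row) = locate′ (∑-positive N {λ v → f (u ℕ.+ 1 ℕ.+ v)} 0<row)
          where
          locate′ : ∃[ v ] v ℕ.< N × 0ℤ < f (u ℕ.+ 1 ℕ.+ v) → ∃[ x ] 1 ℕ.≤ x × x ℕ.< N ℕ.+ N × Sifted x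
          locate′ (v , v<N , 0<f) = u ℕ.+ 1 ℕ.+ v , ℕ.≤-trans (ℕ.m≤n+m 1 u) (ℕ.m≤m+n (u ℕ.+ 1) v) ,
            ℕ.+-mono-≤-< (subst (ℕ._≤ N) (ℕ.+-comm 1 u) u<N) v<N , f>0⇒sifted (u ℕ.+ 1 ℕ.+ v) 0<f

-- Extremal selections of numbers, for sums and products at once.

open import Data.Nat.Base using (_≤_)
open import Relation.Binary.PropositionalEquality using (_≡_)
open import Relation.Binary.Core using (_Preserves₂_⟶_⟶_)
open import Algebra.Structures {A = ℕ} _≡_ using (IsCommutativeMonoid)

module Comparison (_∙_ : ℕ → ℕ → ℕ) (ι : ℕ) (isCM : IsCommutativeMonoid _∙_ ι) (mono : _∙_ Preserves₂ _≤_ ⟶ _≤_ ⟶ _≤_) where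

  open import Data.Nat.Base hiding (_≤_)
  open import Data.Nat.Properties
  open import Data.List.Base using (List; []; _∷_; foldr; map; filter; downFrom)
  open import Data.List.Relation.Unary.All as All using (All; []; _∷_)
  open import Data.List.Relation.Unary.All.Properties using (applyDownFrom⁺₁)
  open import Relation.Nullary using (yes; no; contradiction)
  open import Relation.Unary using (Pred; Decidable)
  open import Relation.Binary.PropositionalEquality
  open import Level using (0ℓ)
  open IsCommutativeMonoid isCM using (comm; assoc; identityˡ; identityʳ)
  open ≤-Reasoning

  fold : (ℕ → ℕ) → List ℕ → ℕ
  fold f xs = foldr _∙_ ι (map f xs)

  module _ {P Q : Pred ℕ 0ℓ} (P? : Decidable P) (Q? : Decidable Q) (P⇒Q : ∀ {x} → P x → Q x) (f g : ℕ → ℕ) where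

    -- With inverses this would say that f/g folded over P is at most f/g folded over Q: the
    -- additional elements of Q have g ≤ f. Cross-multiplied, it makes sense in ℕ for both
    -- operations.
    fold-filter : ∀ xs → All (λ x → g x ≤ f x) xs →
                  fold g (filter Q? xs) ∙ fold f (filter P? xs) ≤ fold g (filter P? xs) ∙ fold f (filter Q? xs)
    fold-filter []       []             = ≤-refl
    fold-filter (x ∷ xs) (g≤f ∷ gs≤fs) with P? x | Q? x
    ... | yes px | no ¬qx = contradiction (P⇒Q px) ¬qx
    ... | no  _  | no _   = fold-filter xs gs≤fs
    ... | yes _  | yes _  = begin
      (g x ∙ gQ) ∙ (f x ∙ fP)  ≡⟨ interchange (g x) gQ (f x) fP ⟩
      (g x ∙ f x) ∙ (gQ ∙ fP)  ≤⟨ mono (≤-refl {g x ∙ f x}) (fold-filter xs gs≤fs) ⟩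
      (g x ∙ f x) ∙ (gP ∙ fQ)  ≡⟨ interchange (g x) (f x) gP fQ ⟩
      (g x ∙ gP) ∙ (f x ∙ fQ)  ∎
      where
      gQ = fold g (filter Q? xs)
      gP = fold g (filter P? xs)
      fQ = fold f (filter Q? xs)
      fP = fold f (filter P? xs)
      interchange : ∀ a b c d → (a ∙ b) ∙ (c ∙ d) ≡ (a ∙ c) ∙ (b ∙ d)
      interchange a b c d = trans (assoc a b (c ∙ d)) (trans (cong (a ∙_) (trans (sym (assoc b c d)) (trans (cong (_∙ d) (comm b c)) (assoc c b d)))) (sym (assoc a c (b ∙ d))))
    ... | no _   | yes _  = begin
      (g x ∙ gQ) ∙ fP          ≡⟨ assoc (g x) gQ fP ⟩
      g x ∙ (gQ ∙ fP)          ≤⟨ mono g≤f (fold-filter xs gs≤fs) ⟩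
      f x ∙ (gP ∙ fQ)          ≡⟨ trans (sym (assoc (f x) gP fQ)) (trans (cong (_∙ fQ) (comm (f x) gP)) (assoc gP (f x) fQ)) ⟩
      gP ∙ (f x ∙ fQ)          ∎
      where
      gQ = fold g (filter Q? xs)
      gP = fold g (filter P? xs)
      fQ = fold f (filter Q? xs)
      fP = fold f (filter P? xs)

    -- Elements of P from Y on satisfy f ≤ g and can only lower the quotient f/g; below Y
    -- `fold-filter` applies.
    fold-downFrom : ∀ Y → (∀ {x} → x < Y → g x ≤ f x) → (∀ {x} → Y ≤ x → f x ≤ g x) → ∀ k →
                    fold g (filter Q? (downFrom Y)) ∙ fold f (filter P? (downFrom (k + Y))) ≤
                    fold g (filter P? (downFrom (k + Y))) ∙ fold f (filter Q? (downFrom Y))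
    fold-downFrom Y g≤f f≤g zero = fold-filter (downFrom Y) (applyDownFrom⁺₁ (λ x → x) Y g≤f)
    fold-downFrom Y g≤f f≤g (suc k) with P? (k + Y)
    ... | no  _ = fold-downFrom Y g≤f f≤g k
    ... | yes _ = begin
      gQ ∙ (f x ∙ fP)  ≡⟨ trans (sym (assoc gQ (f x) fP)) (trans (cong (_∙ fP) (comm gQ (f x))) (assoc (f x) gQ fP)) ⟩
      f x ∙ (gQ ∙ fP)  ≤⟨ mono (f≤g (m≤n+m Y k)) (fold-downFrom Y g≤f f≤g k) ⟩
      g x ∙ (gP ∙ fQ)  ≡⟨ assoc (g x) gP fQ ⟨
      (g x ∙ gP) ∙ fQ  ∎
      where
      x  = k + Y
      gQ = fold g (filter Q? (downFrom Y))
      fQ = fold f (filter Q? (downFrom Y))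
      gP = fold g (filter P? (downFrom (k + Y)))
      fP = fold f (filter P? (downFrom (k + Y)))

module Selections where

  open import Data.Nat.Base
  open import Data.Nat.Properties
  open import Data.Nat.ListAction using (sum; product)
  open import Data.List.Base using (List; []; _∷_; map; filter; downFrom; length)
  open import Data.List.Properties using (map-id)
  open import Relation.Unary using (Pred; Decidable)
  open import Relation.Binary.PropositionalEquality
  open import Level using (0ℓ)
  open import Data.List.Relation.Unary.All as All using (All; []; _∷_)

  module Additive       = Comparison _+_ 0 +-0-isCommutativeMonoid +-mono-≤
  module Multiplicative = Comparison _*_ 1 *-1-isCommutativeMonoid *-mono-≤

  sum-map-const : ∀ t (xs : List ℕ) → sum (map (λ _ → t) xs) ≡ length xs * t
  sum-map-const t []       = refl
  sum-map-const t (x ∷ xs) = cong (t +_) (sum-map-const t xs)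

  product-map-const : ∀ t (xs : List ℕ) → product (map (λ _ → t) xs) ≡ t ^ length xs
  product-map-const t []       = refl
  product-map-const t (x ∷ xs) = cong (t *_) (product-map-const t xs)

  module _ {P Q : Pred ℕ 0ℓ} (P? : Decidable P) (Q? : Decidable Q) (P⇒Q : ∀ {x} → P x → Q x) (Y k : ℕ) where

    private
      selected initial : List ℕ
      selected = filter P? (downFrom (k + Y))
      initial  = filter Q? (downFrom Y)

    -- Comparison with the constant t = w(Y): elements below Y weigh at least t, those from Y on at
    -- most t. So the total surplus over t is largest for the initial segment, and `short` settles
    -- the multiples of t.
    sum-≤ : ∀ (w : ℕ → ℕ) → (∀ {x y} → x ≤ y → w y ≤ w x) → length selected ≤ length initial →
            sum (map w selected) ≤ sum (map w initial)
    sum-≤ w antitone short = +-cancelˡ-≤ (length initial * t) _ _ (begin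
      length initial * t + sum (map w selected)      ≡⟨ cong (_+ sum (map w selected)) (sum-map-const t initial) ⟨
      sum (map (λ _ → t) initial) + sum (map w selected)
        ≤⟨ Additive.fold-downFrom P? Q? P⇒Q w (λ _ → t) Y (λ x<Y → antitone (<⇒≤ x<Y)) antitone k ⟩
      sum (map (λ _ → t) selected) + sum (map w initial)
        ≡⟨ cong (_+ sum (map w initial)) (sum-map-const t selected) ⟩
      length selected * t + sum (map w initial)      ≤⟨ +-monoˡ-≤ _ (*-monoˡ-≤ t short) ⟩
      length initial * t + sum (map w initial)       ∎)
      where
      open ≤-Reasoning
      t = w Y

    -- The same comparison with the constant Y in the role of f and the identity in that of g, which
    -- bounds a product from below.
    product-≤ : .{{NonZero Y}} → length initial ≤ length selected → product initial ≤ product selected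
    product-≤ long = *-cancelʳ-≤ _ _ (Y ^ length selected) {{m^n≢0 Y (length selected)}} (begin
      product initial * Y ^ length selected          ≡⟨ cong₂ _*_ (cong product (map-id initial)) (product-map-const Y selected) ⟨
      product (map (λ x → x) initial) * product (map (λ _ → Y) selected)
        ≤⟨ Multiplicative.fold-downFrom P? Q? P⇒Q (λ _ → Y) (λ x → x) Y <⇒≤ (λ Y≤x → Y≤x) k ⟩
      product (map (λ x → x) selected) * product (map (λ _ → Y) initial)
        ≡⟨ cong₂ _*_ (cong product (map-id selected)) (product-map-const Y initial) ⟩
      product selected * Y ^ length initial          ≤⟨ *-monoʳ-≤ (product selected) (^-monoʳ-≤ Y long) ⟩
      product selected * Y ^ length selected         ∎)
      where open ≤-Reasoning

  module _ {P Q : Pred ℕ 0ℓ} (P? : Decidable P) (Q? : Decidable Q) (P⇒Q : ∀ {x} → P x → Q x) (xs : List ℕ) where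

    length-filter-mono : length (filter P? xs) ≤ length (filter Q? xs)
    length-filter-mono = begin
      length (filter P? xs)         ≡⟨ trans (sum-map-const 1 (filter P? xs)) (*-identityʳ _) ⟨
      sum (map (λ _ → 1) (filter P? xs))
        ≤⟨ m≤n+m _ _ ⟩
      sum (map (λ _ → 0) (filter Q? xs)) + sum (map (λ _ → 1) (filter P? xs))
        ≤⟨ Additive.fold-filter P? Q? P⇒Q (λ _ → 1) (λ _ → 0) xs (All.universal (λ _ → z≤n) xs) ⟩
      sum (map (λ _ → 0) (filter P? xs)) + sum (map (λ _ → 1) (filter Q? xs))
        ≡⟨ cong₂ _+_ (trans (sum-map-const 0 (filter P? xs)) (*-zeroʳ (length (filter P? xs)))) (trans (sum-map-const 1 (filter Q? xs)) (*-identityʳ _)) ⟩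
      length (filter Q? xs)         ∎
      where open ≤-Reasoning

    -- Enlarging the set multiplies ∏ (1 - 1/q) by factors at most 1, so all primes below y are the
    -- worst case for the core.
    totient-ratio : product (map pred (filter Q? xs)) * product (filter P? xs) ≤ product (map pred (filter P? xs)) * product (filter Q? xs)
    totient-ratio = subst₂ (λ a b → product (map pred (filter Q? xs)) * product a ≤ product (map pred (filter P? xs)) * product b)
      (map-id (filter P? xs)) (map-id (filter Q? xs))
      (Multiplicative.fold-filter P? Q? P⇒Q (λ x → x) pred xs (All.universal (λ _ → pred[n]≤n) xs))

-- Square roots, the exponent 5/8 and the case of many prime divisors.

module Estimates where

  open import Data.Nat.Base
  open import Data.Nat.Properties
  open import Data.Nat.DivMod
  open import Data.Nat.Tactic.RingSolver using (solve-∀)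
  open import Data.Nat.ListAction using (product)
  open import Data.List.Base using ([]; _∷_; length)
  open import Data.List.Relation.Unary.All using (All; []; _∷_)
  open import Data.Product.Base using (∃-syntax; _×_; _,_)
  open import Relation.Nullary using (yes; no)
  open Powers
  open import Relation.Binary.PropositionalEquality

  sqrt : ∀ n → ∃[ r ] r * r ≤ n × n < suc r * suc r
  sqrt zero = 0 , z≤n , s≤s z≤n
  sqrt (suc n) with sqrt n
  ... | r , r²≤n , n<r+1² with suc r * suc r ≤? suc n
  ...   | yes r+1²≤n+1 = suc r , r+1²≤n+1 , ≤-<-trans n<r+1² (*-mono-< (n<1+n (suc r)) (n<1+n (suc r)))
  ...   | no  r+1²≰n+1 = r , m≤n⇒m≤1+n r²≤n , ≰⇒> r+1²≰n+1

  -- Rounding √n up to r + 1 costs at most a factor 17/16 in the square, because 16(2r + 1) ≤ r² for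
  -- r ≥ 34, and 1156 = 34².
  sqrt-upper : ∀ n r → 1156 ≤ n → r * r ≤ n → n < suc r * suc r → suc r * suc r * 16 ≤ n * 17
  sqrt-upper n r 1156≤n r²≤n n<r+1² = begin
    suc r * suc r * 16              ≡⟨ expand r ⟩
    r * r * 16 + (r * 32 + 16)      ≤⟨ +-mono-≤ (*-monoˡ-≤ 16 r²≤n) (≤-trans small r²≤n) ⟩
    n * 16 + n                      ≡⟨ collect n ⟩
    n * 17                          ∎
    where
    open ≤-Reasoning
    expand : ∀ r → suc r * suc r * 16 ≡ r * r * 16 + (r * 32 + 16)
    expand = solve-∀
    collect : ∀ n → n * 16 + n ≡ n * 17
    collect = solve-∀
    34≤r : 34 ≤ r
    34≤r = ≮⇒≥ λ r<34 → <⇒≱ (<-≤-trans n<r+1² (*-mono-≤ r<34 r<34)) 1156≤n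
    split : ∀ r → r * 34 ≡ r * 32 + (r + r)
    split = solve-∀
    small : r * 32 + 16 ≤ r * r
    small = begin
      r * 32 + 16       ≤⟨ +-monoʳ-≤ (r * 32) (≤-trans (≤-trans (m≤m+n 16 18) 34≤r) (m≤m+n r r)) ⟩
      r * 32 + (r + r)  ≡⟨ split r ⟨
      r * 34            ≤⟨ *-monoʳ-≤ r 34≤r ⟩
      r * r             ∎

  -- The source of 5/8: P^8 is about n^4, so A^8 ≤ n gives (A P)^8 ≤ n^5. The ratio v/u is the loss
  -- in rounding √n up.
  eighth-power : ∀ u v A P n X → .{{NonZero u}} → X ≤ A * P → P * P * u ≤ n * v → A ^ 8 * v ^ 4 ≤ n * u ^ 4 → X ^ 8 ≤ n ^ 5
  eighth-power u v A P n X X≤AP P²u≤nv A⁸v⁴≤nu⁴ = *-cancelʳ-≤ _ _ (u ^ 4) {{m^n≢0 u 4}} (begin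
    X ^ 8 * u ^ 4                    ≤⟨ *-monoˡ-≤ (u ^ 4) (^-monoˡ-≤ 8 X≤AP) ⟩
    (A * P) ^ 8 * u ^ 4              ≡⟨ regroup₁ A P u ⟩
    A ^ 8 * (P * P * u) ^ 4          ≤⟨ *-monoʳ-≤ (A ^ 8) (^-monoˡ-≤ 4 P²u≤nv) ⟩
    A ^ 8 * (n * v) ^ 4              ≡⟨ regroup₂ (A ^ 8) n v ⟩
    A ^ 8 * v ^ 4 * n ^ 4            ≤⟨ *-monoˡ-≤ (n ^ 4) A⁸v⁴≤nu⁴ ⟩
    n * u ^ 4 * n ^ 4                ≡⟨ regroup₃ n (u ^ 4) ⟩
    n ^ 5 * u ^ 4                    ∎)
    where
    open ≤-Reasoning
    regroup₁ : ∀ A P u → (A * P) ^ 8 * u ^ 4 ≡ A ^ 8 * (P * P * u) ^ 4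
    regroup₁ A P u = trans (cong (_* u ^ 4) (^-distribʳ-* A P 8)) (trans (*-assoc (A ^ 8) (P ^ 8) (u ^ 4))
      (cong (A ^ 8 *_) (trans (cong (_* u ^ 4) (trans (^-distribˡ-+-* P 4 4) (sym (^-distribʳ-* P P 4)))) (sym (^-distribʳ-* (P * P) u 4)))))
    regroup₂ : ∀ a n v → a * (n * v) ^ 4 ≡ a * v ^ 4 * n ^ 4
    regroup₂ a n v = trans (cong (a *_) (trans (^-distribʳ-* n v 4) (*-comm (n ^ 4) (v ^ 4)))) (sym (*-assoc a (v ^ 4) (n ^ 4)))
    regroup₃ : ∀ n x → n * x * n ^ 4 ≡ n ^ 5 * x
    regroup₃ n x = trans (*-assoc n x (n ^ 4)) (trans (cong (n *_) (*-comm x (n ^ 4))) (sym (*-assoc n (n ^ 4) x)))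

  sqrt-scale : ∀ n p A → n ≤ p → 1156 ≤ p → A ^ 8 * 17 ^ 4 ≤ n * 16 ^ 4 → ∃[ P ] 1 ≤ P × p ≤ P * P × (A * P) ^ 8 ≤ p ^ 5
  sqrt-scale n p A n≤p 1156≤p A-small = scale (sqrt p)
    where
    scale : ∃[ r ] r * r ≤ p × p < suc r * suc r → ∃[ P ] 1 ≤ P × p ≤ P * P × (A * P) ^ 8 ≤ p ^ 5
    scale (r , r²≤p , p<P²) = suc r , s≤s z≤n , <⇒≤ p<P² ,
      eighth-power 16 17 A (suc r) p (A * suc r) ≤-refl (sqrt-upper p r 1156≤p r²≤p p<P²) (≤-trans A-small (*-monoˡ-≤ (16 ^ 4) n≤p))

  eighth-power⇒≤ : ∀ {X n} → .{{NonZero n}} → X ^ 8 ≤ n ^ 5 → X ≤ n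
  eighth-power⇒≤ {X} {n} X⁸≤n⁵ = ≮⇒≥ λ n<X → <⇒≱ (^-monoˡ-< 8 n<X) (≤-trans X⁸≤n⁵ (^-monoʳ-≤ n (m≤m+n 5 3)))

  exponents : ∀ k a b {g X n} → 8 * k ≡ a → 5 * k < b → 1 < n → g ≤ X → X ^ 8 ≤ n ^ 5 → g ^ a < n ^ b
  exponents k a b {g} {X} {n} refl 5k<b 1<n g≤X X⁸≤n⁵ = begin-strict
    g ^ (8 * k)    ≤⟨ ^-monoˡ-≤ (8 * k) g≤X ⟩
    X ^ (8 * k)    ≡⟨ ^-*-assoc X 8 k ⟨
    (X ^ 8) ^ k    ≤⟨ ^-monoˡ-≤ k X⁸≤n⁵ ⟩
    (n ^ 5) ^ k    ≡⟨ ^-*-assoc n 5 k ⟩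
    n ^ (5 * k)    <⟨ ^-monoʳ-< n 1<n 5k<b ⟩
    n ^ b          ∎
    where open ≤-Reasoning

  ^-length≤product : ∀ {y} qs → All (y ≤_) qs → y ^ length qs ≤ product qs
  ^-length≤product []       []           = ≤-refl
  ^-length≤product (q ∷ qs) (y≤q ∷ y≤qs) = *-mono-≤ y≤q (^-length≤product qs y≤qs)

  -- The lower bound for p has the form G z^16 Z, with G to the first power only; the other seven
  -- factors of G^8 are charged to Z.
  sixteenth-power : ∀ k v a u {A z G Z} → A ≤ z * (z * G) * k → k ^ 8 * v ≤ a * u → G ^ 7 * a ≤ Z → A ^ 8 * v ≤ G * (z ^ 16 * Z) * u
  sixteenth-power k v a u {A} {z} {G} {Z} A≤ k⁸v≤au G⁷a≤Z = begin
    A ^ 8 * v                             ≤⟨ *-monoˡ-≤ v (^-monoˡ-≤ 8 A≤) ⟩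
    (z * (z * G) * k) ^ 8 * v             ≡⟨ cong (_* v) base ⟩
    z ^ 16 * G ^ 8 * k ^ 8 * v            ≡⟨ *-assoc (z ^ 16 * G ^ 8) (k ^ 8) v ⟩
    z ^ 16 * G ^ 8 * (k ^ 8 * v)          ≤⟨ *-monoʳ-≤ (z ^ 16 * G ^ 8) k⁸v≤au ⟩
    z ^ 16 * G ^ 8 * (a * u)              ≡⟨ regroup (z ^ 16) G (G ^ 7) a u ⟩
    G * (z ^ 16 * (G ^ 7 * a)) * u        ≤⟨ *-monoˡ-≤ u (*-monoʳ-≤ G (*-monoʳ-≤ (z ^ 16) G⁷a≤Z)) ⟩
    G * (z ^ 16 * Z) * u                  ∎
    where
    open ≤-Reasoning
    regroup : ∀ x G g a b → x * (G * g) * (a * b) ≡ G * (x * (g * a)) * b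
    regroup = solve-∀
    base : (z * (z * G) * k) ^ 8 ≡ z ^ 16 * G ^ 8 * k ^ 8
    base = begin-equality
      (z * (z * G) * k) ^ 8          ≡⟨ ^-distribʳ-* (z * (z * G)) k 8 ⟩
      (z * (z * G)) ^ 8 * k ^ 8      ≡⟨ cong (λ x → x ^ 8 * k ^ 8) (*-assoc z z G) ⟨
      (z * z * G) ^ 8 * k ^ 8        ≡⟨ cong (_* k ^ 8) (trans (^-distribʳ-* (z * z) G 8) (cong (_* G ^ 8) (trans (^-distribʳ-* z z 8) (sym (^-distribˡ-+-* z 8 8))))) ⟩
      z ^ 16 * G ^ 8 * k ^ 8         ∎

  -- With z = 6(j + 1), A ≤ 3 z² 2^m and n = 2^m z^s, so the claim reduces to 2^(7m) 2^14 ≤ z^(s -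
  -- 16), where 2^14 covers 3^8 (17/16)^4. Since z ≥ 2^6, it is enough that 14 + 7m ≤ 6(s - 16).
  many-divisors : ∀ j m s C → 15 ≤ j → m ≤ j * 2 + 3 → j * 6 ≤ s + m → suc (s + m) ≤ suc j * 6 →
                  C ≡ suc (s + m) * (suc s * 2 ^ m) → ∀ {A n} → A ≡ 2 * suc C → n ≡ 2 ^ m * (suc j * 6) ^ s → A ^ 8 * 17 ^ 4 ≤ n * 16 ^ 4
  many-divisors j m s C 15≤j m≤ j6≤ω ω<z C≡ {A} {n} A≡ n≡ = subst (λ n → A ^ 8 * 17 ^ 4 ≤ n * 16 ^ 4)
    (trans (cong (G *_) (trans (sym (^-distribˡ-+-* z 16 t)) (cong (z ^_) 16+t≡s))) (sym n≡))
    (sixteenth-power 3 (17 ^ 4) (2 ^ 14) (16 ^ 4) {A} {z} {G} {z ^ t} A≤ (≤ᵇ⇒≤ (3 ^ 8 * 17 ^ 4) (2 ^ 14 * 16 ^ 4) _) G⁷2¹⁴≤zᵗ)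
    where
    open ≤-Reasoning
    z G t : ℕ
    z = suc j * 6
    G = 2 ^ m
    t = s ∸ 16
    C≤ : C ≤ z * (z * G)
    C≤ = subst (_≤ z * (z * G)) (sym C≡) (*-mono-≤ ω<z (*-monoˡ-≤ G (≤-trans (s≤s (m≤m+n s m)) ω<z)))
    2≤C : 2 ≤ C
    2≤C = subst (2 ≤_) (sym C≡) (*-mono-≤ {2} {suc (s + m)} {1} (s≤s (≤-trans (≤-trans (s≤s z≤n) (*-monoˡ-≤ 6 15≤j)) j6≤ω)) (*-mono-≤ (s≤s (z≤n {s})) (m^n>0 2 m)))
    A≤ : A ≤ z * (z * G) * 3
    A≤ = begin
      A                   ≡⟨ A≡ ⟩
      2 * suc C           ≡⟨ double C ⟩
      2 + C * 2           ≤⟨ +-monoˡ-≤ (C * 2) 2≤C ⟩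
      C + C * 2           ≡⟨ triple C ⟩
      C * 3               ≤⟨ *-monoˡ-≤ 3 C≤ ⟩
      z * (z * G) * 3     ∎
      where
      double : ∀ C → 2 * suc C ≡ 2 + C * 2
      double = solve-∀
      triple : ∀ C → C + C * 2 ≡ C * 3
      triple = solve-∀
    -- 6s ≥ 6(6j − m) = 36j − 6m and 36j ≥ 26j + 150 ≥ 13(m − 3) + 150.
    110+7m≤6s : 110 + 7 * m ≤ 6 * s
    110+7m≤6s = +-cancelʳ-≤ (6 * m) _ _ (begin
      110 + 7 * m + 6 * m        ≡⟨ collect₁ m ⟩
      110 + 13 * m               ≤⟨ +-monoʳ-≤ 110 (*-monoʳ-≤ 13 m≤) ⟩
      110 + 13 * (j * 2 + 3)     ≡⟨ collect₂ j ⟩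
      149 + 26 * j               ≤⟨ +-monoˡ-≤ (26 * j) (≤-trans (n≤1+n 149) (*-monoʳ-≤ 10 15≤j)) ⟩
      10 * j + 26 * j            ≡⟨ collect₃ j ⟩
      6 * (j * 6)                ≤⟨ *-monoʳ-≤ 6 j6≤ω ⟩
      6 * (s + m)                ≡⟨ *-distribˡ-+ 6 s m ⟩
      6 * s + 6 * m              ∎)
      where
      collect₁ : ∀ m → 110 + 7 * m + 6 * m ≡ 110 + 13 * m
      collect₁ = solve-∀
      collect₂ : ∀ j → 110 + 13 * (j * 2 + 3) ≡ 149 + 26 * j
      collect₂ = solve-∀
      collect₃ : ∀ j → 10 * j + 26 * j ≡ 6 * (j * 6)
      collect₃ = solve-∀
    16≤s : 16 ≤ s
    16≤s = *-cancelˡ-≤ 6 (≤-trans (≤-trans (m≤m+n 96 14) (m≤m+n 110 (7 * m))) 110+7m≤6s)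
    16+t≡s : 16 + t ≡ s
    16+t≡s = m+[n∸m]≡n 16≤s
    14+7m≤6t : 14 + 7 * m ≤ 6 * t
    14+7m≤6t = +-cancelˡ-≤ 96 _ _ (subst₂ _≤_ (sym (+-assoc 96 14 (7 * m))) (trans (cong (6 *_) (sym 16+t≡s)) (*-distribˡ-+ 6 16 t)) 110+7m≤6s)
    G⁷2¹⁴≤zᵗ : G ^ 7 * 2 ^ 14 ≤ z ^ t
    G⁷2¹⁴≤zᵗ = begin
      G ^ 7 * 2 ^ 14             ≡⟨ cong (_* 2 ^ 14) (^-*-assoc 2 m 7) ⟩
      2 ^ (m * 7) * 2 ^ 14       ≡⟨ ^-distribˡ-+-* 2 (m * 7) 14 ⟨
      2 ^ (m * 7 + 14)           ≤⟨ ^-monoʳ-≤ 2 (subst (_≤ 6 * t) (trans (+-comm 14 (7 * m)) (cong (_+ 14) (*-comm 7 m))) 14+7m≤6t) ⟩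
      2 ^ (6 * t)                ≡⟨ ^-*-assoc 2 6 t ⟨
      64 ^ t                     ≤⟨ ^-monoˡ-≤ t (≤-trans (m≤m+n 64 32) (*-monoˡ-≤ 6 (s≤s 15≤j))) ⟩
      z ^ t                      ∎

-- Numerical data for the core of primes below 11.

module SmallCore where

  open import Data.Nat.Base
  open import Data.Nat.Properties
  open import Data.Nat.DivMod
  open import Data.Nat.Divisibility
  open import Data.Nat.Primality
  open import Data.Nat.ListAction using (sum; product)
  open import Data.List.Base using (List; filter; downFrom; length; map)
  open import Data.Product.Base using (_×_; _,_)
  open import Data.Sum.Base using (inj₁; inj₂)
  open import Relation.Nullary using (¬?; _×-dec_)
  open import Relation.Unary using (Decidable)
  open import Relation.Binary.PropositionalEquality

  -- A superset of the primes from 11 on, decided by four remainders. Passing to a superset is safe: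
  -- its first terms, equally many, have a larger reciprocal sum and a smaller product.
  CoprimeTo210 : ℕ → Set
  CoprimeTo210 q = 11 ≤ q × q % 2 ≢ 0 × q % 3 ≢ 0 × q % 5 ≢ 0 × q % 7 ≢ 0

  coprimeTo210? : Decidable CoprimeTo210
  coprimeTo210? q = (11 ≤? q) ×-dec ¬? (q % 2 ≟ 0) ×-dec ¬? (q % 3 ≟ 0) ×-dec ¬? (q % 5 ≟ 0) ×-dec ¬? (q % 7 ≟ 0)

  prime⇒coprimeTo210 : ∀ {q} → 11 ≤ q → Prime q → CoprimeTo210 q
  prime⇒coprimeTo210 {q} 11≤q q-prime = 11≤q , go 2 (≤ᵇ⇒≤ 2 2 _) (≤ᵇ⇒≤ 3 11 _) , go 3 (≤ᵇ⇒≤ 2 3 _) (≤ᵇ⇒≤ 4 11 _) , go 5 (≤ᵇ⇒≤ 2 5 _) (≤ᵇ⇒≤ 6 11 _) , go 7 (≤ᵇ⇒≤ 2 7 _) (≤ᵇ⇒≤ 8 11 _)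
    where
    go : ∀ d .{{_ : NonZero d}} → 2 ≤ d → d < 11 → q % d ≢ 0
    go d 2≤d d<11 q%d≡0 with prime⇒irreducible q-prime (m%n≡0⇒n∣m q d q%d≡0)
    ... | inj₁ refl = <⇒≱ 2≤d ≤-refl
    ... | inj₂ refl = <⇒≱ d<11 11≤q

  -- The value at 0 is the one at 1, which keeps the function decreasing.
  reciprocal : ℕ → ℕ → ℕ
  reciprocal Q q = suc (Q / suc (pred q))

  reciprocal-antitone : ∀ Q {x y} → x ≤ y → reciprocal Q y ≤ reciprocal Q x
  reciprocal-antitone Q x≤y = s≤s (/-monoʳ-≤ Q (s≤s (pred-mono-≤ x≤y)))

  reciprocal-* : ∀ Q q → .{{NonZero q}} → Q ≤ reciprocal Q q * q
  reciprocal-* Q q@(suc _) = begin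
    Q                       ≡⟨ m≡m%n+[m/n]*n Q q ⟩
    Q % q + Q / q * q       ≤⟨ +-monoˡ-≤ (Q / q * q) (<⇒≤ (m%n<n Q q)) ⟩
    q + Q / q * q           ∎
    where open ≤-Reasoning

  sample : ℕ → List ℕ
  sample Y = filter coprimeTo210? (downFrom Y)

  sample-113 : length (sample 113) ≡ 25 × sum (map (reciprocal 1000000) (sample 113)) ≡ 664770
  sample-113 = refl , refl

  -- Below 121 = 11² the sample has no composite entries: these are the 26 primes from 11 to 113.
  -- Their product bounds p from below once M has 26 prime divisors from 11 on.
  sample-121 : length (sample 121) ≡ 26 × 15 * 10 ^ 43 ≤ product (sample 121)
  sample-121 = refl , ≤ᵇ⇒≤ _ _ _

  -- Of the 89 entries 16 are composite, from 121 to 391; the sum still stays below 10^6, which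
  -- keeps δ positive.
  sample-397 : length (sample 397) ≡ 89 × sum (map (reciprocal 1000000) (sample 397)) ≡ 947895
  sample-397 = refl , refl

  small-primes : product (filter prime? (downFrom 11)) ≡ 210 × product (map pred (filter prime? (downFrom 11))) ≡ 48 × length (filter prime? (downFrom 11)) ≡ 4
  small-primes = refl , refl , refl

-- Existence of a small primitive root, by the number of prime divisors.

open import Data.Nat using (ℕ; _^_; _<_; _*_; NonZero)

module Existence (M : ℕ) (p-prime : Prime (suc M)) (p-large : 267 * 10 ^ 30 < suc M) where

  open import Data.Nat.Base
  open import Data.Nat.Properties
  open import Data.Nat.DivMod
  open import Data.Nat.Primality
  open import Data.Nat.ListAction using (sum; product)
  open import Data.Nat.Tactic.RingSolver using (solve-∀)
  open import Data.List.Base using (List; filter; downFrom; length; map)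
  open import Data.List.Relation.Unary.All as All using (All)
  open import Data.Product.Base using (∃-syntax; Σ-syntax; _×_; _,_; proj₁; proj₂)
  open import Relation.Nullary using (¬_; Dec; yes; no)
  open import Relation.Binary.PropositionalEquality
  open Residues M p-prime using (p; 1<p; _≈_)
  open Sieve M p-prime
  open PrimeLists using (prime⇒2≤)
  open PrimeLists.Divisors M M≢0
  open Selections
  open SmallCore
  open Estimates

  SmallRoot : Set
  SmallRoot = ∃[ x ] ∃[ X ] 1 ≤ x × x < X × X ^ 8 ≤ p ^ 5 × IsPrimitiveRoot p x

  1156≤p : 1156 ≤ p
  1156≤p = ≤-trans (≤ᵇ⇒≤ 1156 (267 * 10 ^ 30) _) (<⇒≤ p-large)

  -- C is an integer upper bound for 2^m (s + 1)/(θδ), and n a lower bound for p that is large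
  -- enough for (2(C + 1)P)^8 ≤ p^5.
  sieve : ∀ y (w : ℕ → ℕ) b c δ α β C n → All (λ q → b ≤ w q * q) (rest y) → sum (map w (rest y)) ≤ c → δ + c ≤ b →
          α * product (core y) ≤ β * product (map pred (core y)) → 0 < δ * α →
          b * β * (suc (length (rest y)) * 2 ^ length (core y)) ≤ C * (δ * α) →
          n ≤ p → (2 * suc C) ^ 8 * 17 ^ 4 ≤ n * 16 ^ 4 → SmallRoot
  sieve y w b c δ α β C n b≤w ∑w≤c δ+c≤b αΠ≤βφ 0<δα cost≤C n≤p C-small = finish (sqrt-scale n p (2 * suc C) n≤p 1156≤p C-small)
    where
    open Count (core y) (core-∣ y) (core-coprime y)
    finish : ∃[ P ] 1 ≤ P × p ≤ P * P × (2 * suc C * P) ^ 8 ≤ p ^ 5 → SmallRoot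
    finish (P , 1≤P , p≤P² , X⁸≤p⁵) = root (sifted (rest y) (All.map (λ large → rest-*-core y large , rest-coprime y large) (rest-prime y)) N P 2N≤p p≤P²
      w b c δ α β b≤w ∑w≤c δ+c≤b αΠ≤βφ large)
      where
      N X : ℕ
      -- The successor makes `large` strict, and 1 ≤ P keeps N within (C + 1)P.
      N = suc (C * P)
      X = 2 * suc C * P
      2N≤X : N + N ≤ X
      2N≤X = ≤-trans (+-mono-≤ N≤ N≤) (≤-reflexive (double (suc C) P))
        where
        N≤ : N ≤ suc C * P
        N≤ = +-monoˡ-≤ (C * P) 1≤P
        double : ∀ a b → a * b + a * b ≡ 2 * a * b
        double = solve-∀
      2N≤p : N + N ≤ p
      2N≤p = ≤-trans 2N≤X (eighth-power⇒≤ X⁸≤p⁵)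
      large : b * β * (suc (length (rest y)) * 2 ^ length (core y) * P) < N * (δ * α)
      large = begin-strict
        b * β * (suc (length (rest y)) * 2 ^ length (core y) * P)   ≡⟨ *-assoc (b * β) (suc (length (rest y)) * 2 ^ length (core y)) P ⟨
        b * β * (suc (length (rest y)) * 2 ^ length (core y)) * P   ≤⟨ *-monoˡ-≤ P cost≤C ⟩
        C * (δ * α) * P                                             ≡⟨ swap C (δ * α) P ⟩
        C * P * (δ * α)                                             <⟨ m<n+m (C * P * (δ * α)) 0<δα ⟩
        N * (δ * α)                                                 ∎
        where
        open ≤-Reasoning
        swap : ∀ a b c → a * b * c ≡ a * c * b
        swap = solve-∀
      root : ∃[ x ] 1 ≤ x × x < N + N × x ^ cofactor 1 ≈ 1 × All (λ q → ¬ x ^ cofactor q ≈ 1) (core y) × All (λ q → ¬ x ^ cofactor q ≈ 1) (rest y) → SmallRoot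
      root (x , 1≤x , x<2N , xM≈1 , avoids-core , avoids-rest) = x , X , 1≤x , <-≤-trans x<2N 2N≤X , X⁸≤p⁵ ,
        avoids⇒primitive x xM≈1 (λ q-prime q∣M → covered y avoids-core avoids-rest q-prime q∣M)

  rest-product : ∀ y → product (rest y) * product (core y) < p
  rest-product y = s≤s (core-rest-≤ y)

  core-large : ∀ y → 2 ^ length (core y) ≤ product (core y)
  core-large y = ^-length≤product (core y) (All.map (λ (q-prime , _) → prime⇒2≤ q-prime) (core-prime y))

  core-totient-ratio : ∀ y π φ → product (filter prime? (downFrom y)) ≡ π → product (map pred (filter prime? (downFrom y))) ≡ φ →
                       φ * product (core y) ≤ π * product (map pred (core y))
  core-totient-ratio y π φ refl refl = ≤-trans (totient-ratio PrimeDivisor? prime? proj₁ (downFrom y))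
    (≤-reflexive (*-comm (product (map pred (core y))) (product (filter prime? (downFrom y)))))

  core-length : ∀ y l → length (filter prime? (downFrom y)) ≡ l → length (core y) ≤ l
  core-length y l refl = length-filter-mono PrimeDivisor? prime? proj₁ (downFrom y)

  -- A variable in place of the literal 11, with which core y and rest y would unfold during conversion checking.
  module SmallPrimesCore (y : ℕ) (y≡11 : y ≡ 11) where

    small-primes-y : product (filter prime? (downFrom y)) ≡ 210 × product (map pred (filter prime? (downFrom y))) ≡ 48 × length (filter prime? (downFrom y)) ≡ 4
    small-primes-y = subst (λ y → product (filter prime? (downFrom y)) ≡ 210 × product (map pred (filter prime? (downFrom y))) ≡ 48 × length (filter prime? (downFrom y)) ≡ 4)
      (sym y≡11) small-primes

    large⇒coprime : ∀ {q} → y ≤ q × PrimeDivisor q → CoprimeTo210 q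
    large⇒coprime (y≤q , q-prime , _) = prime⇒coprimeTo210 (subst (_≤ _) y≡11 y≤q) q-prime

    module _ (Y : ℕ) (Y≤1156 : Y ≤ 1156) where

      private
        rest′ : ℕ → List ℕ
        rest′ n = filter (LargeDivisor? y) (downFrom n)

        n≡ : suc M + y ∸ Y + Y ≡ suc M + y
        n≡ = m∸n+n≡m (≤-trans Y≤1156 (≤-trans 1156≤p (m≤m+n p y)))

      rest-sum-≤ : ∀ Q → length (rest y) ≤ length (sample Y) → sum (map (reciprocal Q) (rest y)) ≤ sum (map (reciprocal Q) (sample Y))
      rest-sum-≤ Q = subst (λ n → length (rest′ n) ≤ length (sample Y) → sum (map (reciprocal Q) (rest′ n)) ≤ sum (map (reciprocal Q) (sample Y))) n≡
        (sum-≤ (LargeDivisor? y) coprimeTo210? large⇒coprime Y (suc M + y ∸ Y) (reciprocal Q) (reciprocal-antitone Q))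

      rest-product-≥ : ∀ S n → .{{NonZero Y}} → length (sample Y) ≡ S → n ≤ product (sample Y) → S ≤ length (rest y) → n ≤ p
      rest-product-≥ S n refl n≤ S≤ = begin
        n                                       ≤⟨ n≤ ⟩
        product (sample Y)                      ≤⟨ subst (λ n → length (sample Y) ≤ length (rest′ n) → product (sample Y) ≤ product (rest′ n)) n≡
                                                     (product-≤ (LargeDivisor? y) coprimeTo210? large⇒coprime Y (suc M + y ∸ Y)) S≤ ⟩
        product (rest y)                        ≤⟨ m≤m*n (product (rest y)) (product (core y)) {{productOfPrimes≢0 (All.map proj₁ (core-prime y))}} ⟩
        product (rest y) * product (core y)     ≤⟨ <⇒≤ (rest-product y) ⟩
        p                                       ∎
        where open ≤-Reasoning

      -- The worst case is taken for the core, 2, 3, 5 and 7 all dividing M, so θ = 48/210 and m =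
      -- 4, and for the rest, the S smallest candidates.
      few-divisors : ∀ S Q c δ C n → length (sample Y) ≡ S → sum (map (reciprocal Q) (sample Y)) ≡ c → δ + c ≤ Q → 0 < δ * 48 →
                     Q * 210 * (suc S * 2 ^ 4) ≤ C * (δ * 48) → n ≤ p → (2 * suc C) ^ 8 * 17 ^ 4 ≤ n * 16 ^ 4 →
                     length (rest y) ≤ S → SmallRoot
      few-divisors S Q c δ C n length≡S sum≡c δ+c≤Q 0<δ cost≤C n≤p C-small s≤S =
        sieve y (reciprocal Q) Q c δ 48 210 C n
          (All.map (λ { {q} (_ , q-prime , _) → reciprocal-* Q q {{prime⇒nonZero q-prime}} }) (rest-prime y))
          (subst (sum (map (reciprocal Q) (rest y)) ≤_) sum≡c (rest-sum-≤ Q (subst (length (rest y) ≤_) (sym length≡S) s≤S)))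
          δ+c≤Q (core-totient-ratio y 210 48 (proj₁ small-primes-y) (proj₁ (proj₂ small-primes-y))) 0<δ
          (≤-trans (*-monoʳ-≤ (Q * 210) (*-mono-≤ (s≤s s≤S) (^-monoʳ-≤ 2 (core-length y 4 (proj₂ (proj₂ small-primes-y)))))) cost≤C)
          n≤p C-small

    -- c = ∑ (⌊10⁶ / q⌋ + 1) over the sample, δ = 10⁶ − c, and C is the least integer satisfying the cost bound.
    root-≤25 : length (rest y) ≤ 25 → SmallRoot
    root-≤25 = few-divisors 113 (≤ᵇ⇒≤ _ _ _) 25 1000000 664770 335230 5430 (267 * 10 ^ 30) (proj₁ sample-113) (proj₂ sample-113)
      (≤ᵇ⇒≤ _ _ _) (≤ᵇ⇒≤ _ _ _) (≤ᵇ⇒≤ _ _ _) (<⇒≤ p-large) (≤ᵇ⇒≤ ((2 * suc 5430) ^ 8 * 17 ^ 4) (267 * 10 ^ 30 * 16 ^ 4) _)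

    -- With 26 prime divisors from 11 on, p is at least 15·10^43. The limit 89 hands over to
    -- `many-divisors`, whose condition 15 ≤ j amounts to 90 = 6·15 prime divisors.
    root-≤89 : 26 ≤ length (rest y) → length (rest y) ≤ 89 → SmallRoot
    root-≤89 26≤s = few-divisors 397 (≤ᵇ⇒≤ _ _ _) 89 1000000 947895 52105 120910 (15 * 10 ^ 43) (proj₁ sample-397) (proj₂ sample-397)
      (≤ᵇ⇒≤ _ _ _) (≤ᵇ⇒≤ _ _ _) (≤ᵇ⇒≤ _ _ _)
      (rest-product-≥ 121 (≤ᵇ⇒≤ _ _ _) 26 (15 * 10 ^ 43) (proj₁ sample-121) (proj₂ sample-121) 26≤s)
      (≤ᵇ⇒≤ ((2 * suc 120910) ^ 8 * 17 ^ 4) (15 * 10 ^ 43 * 16 ^ 4) _)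

  -- The cut z is the first multiple of 6 above ω. Each q of the rest exceeds ω, so ∑ 1/q ≤ s/(ω +
  -- 1) and, as s + m = ω, 1 - ∑ 1/q ≥ (m + 1)/(ω + 1); moreover θ ≥ 1/(m + 1). The factors m + 1
  -- cancel and leave the cost C = (ω + 1)(s + 1) 2^m.
  root->89 : ∀ ω j z → ω ≡ length (core (suc M)) → j ≡ ω / 6 → z ≡ suc j * 6 → 90 ≤ ω → SmallRoot
  root->89 ω j z ω≡ j≡ z≡ 90≤ω = sieve z (λ _ → 1) (suc ω) s (suc m) 1 (suc m) C (2 ^ m * z ^ s)
    (All.map (λ (z≤q , _) → ≤-trans ω<z (≤-trans z≤q (≤-reflexive (sym (*-identityˡ _))))) (rest-prime z))
    (≤-reflexive (trans (sum-map-const 1 (rest z)) (*-identityʳ s)))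
    (≤-reflexive (cong suc (trans (+-comm m s) s+m≡ω)))
    (subst (_≤ suc m * product (map pred (core z))) (sym (*-identityˡ (product (core z)))) Π≤)
    z<s (≤-reflexive (regroup (suc ω) (suc m) (suc s * 2 ^ m))) Gzˢ≤p
    (many-divisors j m s C 15≤j m≤ (subst (j * 6 ≤_) (sym s+m≡ω) j6≤ω) (subst₂ (λ n z → suc n ≤ z) (sym s+m≡ω) z≡ ω<z)
      (cong (λ n → suc n * (suc s * 2 ^ m)) (sym s+m≡ω)) {2 * suc C} {2 ^ m * z ^ s} refl (cong (λ z → 2 ^ m * z ^ s) z≡))
    where
    open ≤-Reasoning
    s m C : ℕ
    s = length (rest z)
    m = length (core z)
    C = suc ω * (suc s * 2 ^ m)
    s+m≡ω : s + m ≡ ω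
    s+m≡ω = trans (rest+core z) (sym ω≡)
    15≤j : 15 ≤ j
    15≤j = subst (15 ≤_) (sym j≡) (/-monoˡ-≤ 6 90≤ω)
    j6≤ω : j * 6 ≤ ω
    j6≤ω = subst (λ j → j * 6 ≤ ω) (sym j≡) (m/n*n≤m ω 6)
    m≤ : m ≤ j * 2 + 3
    m≤ = subst (λ z → length (core z) ≤ j * 2 + 3) (sym z≡) (core-≤ j)
    z≡2+k : z ≡ 2 + (4 + j * 6)
    z≡2+k = z≡
    Π≤ : product (core z) ≤ suc m * product (map pred (core z))
    Π≤ = subst (λ z → product (core z) ≤ suc (length (core z)) * product (map pred (core z))) (sym z≡2+k) (proj₂ (core-totient (4 + j * 6)))
    ω<z : ω < z
    ω<z = begin-strict
      ω                  ≡⟨ m≡m%n+[m/n]*n ω 6 ⟩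
      ω % 6 + ω / 6 * 6  <⟨ +-monoˡ-< (ω / 6 * 6) (m%n<n ω 6) ⟩
      6 + ω / 6 * 6      ≡⟨ cong (λ j → suc j * 6) j≡ ⟨
      suc j * 6          ≡⟨ z≡ ⟨
      z                  ∎
    regroup : ∀ b β x → b * β * x ≡ b * x * (β * 1)
    regroup = solve-∀
    Gzˢ≤p : 2 ^ m * z ^ s ≤ p
    Gzˢ≤p = begin
      2 ^ m * z ^ s                           ≤⟨ *-mono-≤ (core-large z) (^-length≤product (rest z) (All.map proj₁ (rest-prime z))) ⟩
      product (core z) * product (rest z)     ≡⟨ *-comm (product (core z)) (product (rest z)) ⟩
      product (rest z) * product (core z)     ≤⟨ <⇒≤ (rest-product z) ⟩
      p                                       ∎

  small-root : SmallRoot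
  small-root = from 11 refl
    where
    from : ∀ y → y ≡ 11 → SmallRoot
    from y y≡11 = by-size (length (rest y) ≤? 25) (length (rest y) ≤? 89)
      where
      by-size : Dec (length (rest y) ≤ 25) → Dec (length (rest y) ≤ 89) → SmallRoot
      by-size (yes s≤25) _          = SmallPrimesCore.root-≤25 y y≡11 s≤25
      by-size (no  s≰25) (yes s≤89) = SmallPrimesCore.root-≤89 y y≡11 (≰⇒> s≰25) s≤89
      by-size (no  _)    (no  s≰89) = root->89 (length (core (suc M))) _ _ refl refl refl
        (≤-trans (≰⇒> s≰89) (≤-trans (m≤m+n (length (rest y)) (length (core y))) (≤-reflexive (rest+core y))))

-- The least primitive root and the final exponent.

open import Data.Nat.Base
open import Data.Nat.Properties
open import Data.Nat.Induction using (<-rec)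
open import Data.Product using (Σ; ∃-syntax; _×_; _,_)
open import Relation.Nullary using (¬_; Dec; yes; no; ¬?; _×-dec_; _→-dec_; contradiction; map′)
open import Relation.Unary using (Pred; Decidable)
open import Relation.Binary.PropositionalEquality
open import Level using (0ℓ)

least : ∀ {P : Pred ℕ 0ℓ} → Decidable P → ∀ n → P n → ∃[ m ] m ≤ n × P m × (∀ k → k < m → ¬ P k)
least {P} P? = <-rec _ λ n rec Pn → search n (λ k<n → rec k<n) Pn (anyUpTo? P? n)
  where
  Least : ℕ → Set
  Least n = ∃[ m ] m ≤ n × P m × (∀ k → k < m → ¬ P k)
  search : ∀ n → (∀ {k} → k < n → P k → Least k) → P n → Dec (∃[ k ] k < n × P k) → Least n
  search n rec Pn (no ¬any) = n , ≤-refl , Pn , λ k k<n Pk → ¬any (k , k<n , Pk)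
  search n rec Pn (yes (k , k<n , Pk)) with rec k<n Pk
  ... | m , m≤k , Pm , minimal = m , ≤-trans m≤k (<⇒≤ k<n) , Pm , minimal

isPrimitiveRoot? : ∀ p → .{{_ : NonZero p}} → Decidable (IsPrimitiveRoot p)
isPrimitiveRoot? p g = (g ^ (p ∸ 1) % p ≟ 1 % p) ×-dec
  map′ (λ f k 1≤k k<p-1 → f k<p-1 1≤k) (λ f {k} k<p-1 1≤k → f k 1≤k k<p-1)
    (allUpTo? (λ k → (1 ≤? k) →-dec ¬? (g ^ k % p ≟ 1 % p)) (p ∸ 1))

theorem1 : (p : ℕ) → .{{_ : NonZero p}} → Prime p → 267 * 10 ^ 30 < p →
    Σ ℕ (λ g → IsLeastPrimitiveRoot p g × (g ^ 10000 < p ^ 6309))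
theorem1 zero    _       0>    = contradiction 0> n≮0
theorem1 (suc M) p-prime large = conclude (Existence.small-root M p-prime large)
  where
  candidate? : Decidable (λ g → 1 ≤ g × IsPrimitiveRoot (suc M) g)
  candidate? g = (1 ≤? g) ×-dec isPrimitiveRoot? (suc M) g
  conclude : ∃[ x ] ∃[ X ] 1 ≤ x × x < X × X ^ 8 ≤ suc M ^ 5 × IsPrimitiveRoot (suc M) x →
             Σ ℕ (λ g → IsLeastPrimitiveRoot (suc M) g × (g ^ 10000 < suc M ^ 6309))
  conclude (x , X , 1≤x , x<X , X⁸≤p⁵ , x-root) = bound (least candidate? x (1≤x , x-root))
    where
    bound : ∃[ g ] g ≤ x × (1 ≤ g × IsPrimitiveRoot (suc M) g) × (∀ h → h < g → ¬ (1 ≤ h × IsPrimitiveRoot (suc M) h)) →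
            Σ ℕ (λ g → IsLeastPrimitiveRoot (suc M) g × (g ^ 10000 < suc M ^ 6309))
    bound (g , g≤x , (1≤g , g-root) , minimal) =
      g , (1≤g , g-root , λ h 1≤h h<g h-root → minimal h h<g (1≤h , h-root)) ,
      -- Over the denominator 10000 the exponent 5/8 is 6250/10000: 8·1250 = 10000 and 5·1250 = 6250
      -- < 6309.
      Estimates.exponents 1250 10000 6309 {g} {X} {suc M} refl (≤ᵇ⇒≤ _ _ _) (Residues.1<p M p-prime) (≤-trans g≤x (<⇒≤ x<X)) X⁸≤p⁵
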